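{- Let $k\in\mathbb{N}$ be a fixed constant. The Almost Disjoint Paths problem (ADP) with this fixed $k$ can be solved in polynomial time on directed acyclic graphs: there is a polynomial-time algorithm that, given a directed acyclic graph $G=(V,A)$ and vertices $s,t\in V$, decides whether $G$ contains $k$ almost disjoint $s$-$t$-paths.
   Context: Directed graphs may contain parallel arcs; paths are directed paths without repeated vertices. A set of paths is called almost disjoint if every two paths of the set have at most one arc in common. The Almost Disjoint Paths problem (ADP): given a directed graph $G=(V,A)$, vertices $s,t\in V$, and $k\in\mathbb{N}$, decide whether there exist $k$ $s$-$t$-paths in $G$ that are pairwise almost disjoint. -}

module Defs where

open import Data.Bool using (Bool; true; false; if_then_else_)
open import Data.Fin using (Fin; toℕ)
open import Data.List using (List; []; _∷_; map; foldr; tabulate)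
open import Data.List.Membership.Propositional using (_∈_)
open import Data.List.Relation.Unary.Unique.Propositional using (Unique)
open import Data.Nat using (ℕ; zero; suc; _+_; _*_; _^_; _≤_; _≡ᵇ_)
open import Data.Product using (Σ-syntax; ∃-syntax; _×_; _,_)
open import Function.Definitions using (Injective)
open import Relation.Binary.PropositionalEquality using (_≡_; _≢_)
open import Relation.Nullary using (¬_; Reflects)

-- Finite directed multigraphs: arcs have an identity of their own, so parallel
-- arcs (and loops) are possible.

record Digraph : Set where
  field
    #V #A   : ℕ
    src tgt : Fin #A → Fin #V

  Vertex : Set
  Vertex = Fin #V

  Arc : Set
  Arc = Fin #A

module _ (G : Digraph) where
  open Digraph G

  IsWalk : Vertex → Vertex → List Arc → Set
  IsWalk u w []       = u ≡ w
  IsWalk u w (a ∷ as) = src a ≡ u × IsWalk (tgt a) w as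

  -- The vertices visited by a walk as starting in u are u ∷ map tgt as.
  IsPath : Vertex → Vertex → List Arc → Set
  IsPath u w as = IsWalk u w as × Unique (u ∷ map tgt as)

  IsCycle : Vertex → List Arc → Set
  IsCycle v as = IsWalk v v as × as ≢ [] × Unique (map tgt as)

  Acyclic : Set
  Acyclic = ∀ v as → ¬ IsCycle v as

  -- At most one common arc.
  AlmostDisjoint : List Arc → List Arc → Set
  AlmostDisjoint p q =
    ∀ {a b} → a ∈ p → a ∈ q → b ∈ p → b ∈ q → a ≡ b

  -- A set of k paths, hence injectivity: k copies of a one-arc path do not
  -- count as k paths.
  HasAlmostDisjointPaths : ℕ → Vertex → Vertex → Set
  HasAlmostDisjointPaths k s t =
    Σ[ P ∈ (Fin k → List Arc) ]
      (∀ i → IsPath s t (P i)) ×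
      Injective _≡_ _≡_ P ×
      (∀ i j → i ≢ j → AlmostDisjoint (P i) (P j))

-- The model of computation is the language WHILE of N. D. Jones, "Computability
-- and Complexity from a Programming Perspective" (MIT Press, 1997), with nil as
-- the only atom and only constant, and with one time unit charged for each
-- operation, assignment and loop test.  Unit-cost cons is
-- realistic because trees can be shared and are inspected only by hd, tl and the
-- test for nil; polynomial time in WHILE coincides with polynomial time on
-- Turing machines.

data Tree : Set where
  nil  : Tree
  cons : Tree → Tree → Tree

hd tl : Tree → Tree
hd nil        = nil
hd (cons l _) = l
tl nil        = nil
tl (cons _ r) = r

Var : Set
Var = ℕ

data Expr : Set where
  var   : Var → Expr
  nilᵉ  : Expr
  consᵉ : Expr → Expr → Expr
  hdᵉ   : Expr → Expr
  tlᵉ   : Expr → Expr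

infix  6 _≔_
infixr 5 _⨾_

data Cmd : Set where
  _≔_   : Var → Expr → Cmd
  _⨾_   : Cmd → Cmd → Cmd
  while : Expr → Cmd → Cmd

Store : Set
Store = Var → Tree

_[_↦_] : Store → Var → Tree → Store
(σ [ x ↦ d ]) y = if y ≡ᵇ x then d else σ y

⟦_⟧ : Expr → Store → Tree
⟦ var x ⟧     σ = σ x
⟦ nilᵉ ⟧      σ = nil
⟦ consᵉ e f ⟧ σ = cons (⟦ e ⟧ σ) (⟦ f ⟧ σ)
⟦ hdᵉ e ⟧     σ = hd (⟦ e ⟧ σ)
⟦ tlᵉ e ⟧     σ = tl (⟦ e ⟧ σ)

time : Expr → ℕ
time (var _)     = 1
time nilᵉ        = 1
time (consᵉ e f) = 1 + time e + time f
time (hdᵉ e)     = 1 + time e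
time (tlᵉ e)     = 1 + time e

-- ⟨ c , σ ⟩⇓[ n ] τ : started in σ, the command c halts in τ after n time units.
-- The rules are deterministic: c and σ determine n and τ.
infix 4 ⟨_,_⟩⇓[_]_

data ⟨_,_⟩⇓[_]_ : Cmd → Store → ℕ → Store → Set where
  assign : ∀ {x e σ} →
    ⟨ x ≔ e , σ ⟩⇓[ 1 + time e ] (σ [ x ↦ ⟦ e ⟧ σ ])
  seq : ∀ {c d σ τ υ m n} →
    ⟨ c , σ ⟩⇓[ m ] τ → ⟨ d , τ ⟩⇓[ n ] υ →
    ⟨ c ⨾ d , σ ⟩⇓[ m + n ] υ
  while-stop : ∀ {e c σ} →
    ⟦ e ⟧ σ ≡ nil →
    ⟨ while e c , σ ⟩⇓[ 1 + time e ] σ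
  while-step : ∀ {e c σ τ υ m n} →
    ⟦ e ⟧ σ ≢ nil →
    ⟨ c , σ ⟩⇓[ m ] τ → ⟨ while e c , τ ⟩⇓[ n ] υ →
    ⟨ while e c , σ ⟩⇓[ 1 + time e + m + n ] υ

-- Variable 0 holds the input and, upon termination, the output.
input : Tree → Store
input d zero    = d
input d (suc _) = nil

output : Store → Tree
output σ = σ 0

encodeBool : Bool → Tree
encodeBool true  = cons nil nil
encodeBool false = nil

-- A single program, with time bound c · Nᵈ + c on all inputs of size N.
DecidableInPolynomialTime :
  {I : Set} → (I → Tree) → (I → ℕ) → (I → Set) → Set
DecidableInPolynomialTime {I} encode size Q =
  Σ[ p ∈ Cmd ] Σ[ c ∈ ℕ ] Σ[ d ∈ ℕ ]
    ((i : I) →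
      ∃[ n ] ∃[ τ ] ∃[ b ]
        ⟨ p , input (encode i) ⟩⇓[ n ] τ ×
        n ≤ c * size i ^ d + c ×
        output τ ≡ encodeBool b ×
        Reflects (Q i) b)

record DAGInstance : Set where
  field
    graph : Digraph
  open Digraph graph public
  field
    acyclic : Acyclic graph
    s t     : Vertex

-- Time is measured against |V| + |A| and not against the size of the encoding,
-- so writing vertex numbers in unary does not relax the time bound.
size : DAGInstance → ℕ
size I = #V + #A
  where open DAGInstance I

encodeℕ : ℕ → Tree
encodeℕ zero    = nil
encodeℕ (suc n) = cons nil (encodeℕ n)

encodeList : List Tree → Tree
encodeList = foldr cons nil

-- (|V| . (arc list . (s . t))), an arc being the pair of its end vertices.
encode : DAGInstance → Tree
encode I =
  cons (encodeℕ #V)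
    (cons (encodeList (tabulate λ a → cons (vertex (src a)) (vertex (tgt a))))
      (cons (vertex s) (vertex t)))
  where
  open DAGInstance I
  vertex : Vertex → Tree
  vertex v = encodeℕ (toℕ v)

ADP : ℕ → DAGInstance → Set
ADP k I = HasAlmostDisjointPaths graph k s t
  where open DAGInstance I

{-# OPTIONS --safe #-}

-- Let s ≠ t; otherwise the empty path is the only s-t-path.  Guess for every pair
-- i, j of paths an arc g i j that they may share, never an arc from s to t: since
-- two equal almost disjoint paths consist of a single such arc, this also forces
-- the paths to be distinct.  Put k tokens on arcs leaving s.  Call level r
-- the set of arcs that end a walk of 1 + r arcs.  In round r a token may move on
-- from an arc a only if a is in level r but not in level 1 + r.  So two tokens
-- that both traverse a stand on a simultaneously, and sharing can be checked on
-- the current k-tuple of arcs alone.  The levels are exhausted after |V| rounds,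
-- and there are only |A| ^ k tuples and |A| ^ (k * k) guesses.
--
-- The search is written in a small functional language whose only loop is a fold
-- over a list; if the lists have length at most M, then a term e takes time at
-- most coeff e * M ^ degree e when compiled to WHILE.
module Submission where

open import Defs
open import Data.Bool as Bool using (true; false; if_then_else_)
open import Data.Empty using (⊥-elim)
open import Data.Fin as Fin using (Fin; zero; suc; toℕ)
import Data.Fin.Properties as Fin
open import Data.List as List using (List; []; _∷_; map; length; _∷ʳ_)
open import Data.List.Properties using (length-++; length-map)
open import Data.List.Membership.Propositional using (_∈_; find; lose)
open import Data.List.Membership.Propositional.Properties using (∈-lookup)
open import Data.List.Relation.Unary.All as All using (All; []; _∷_)
open import Data.List.Relation.Unary.AllPairs using ([]; _∷_)
open import Data.List.Relation.Unary.Any as Any using (Any; here; there)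
open import Data.List.Relation.Unary.Unique.Propositional using (Unique)
open import Data.Nat
open import Data.Nat.Properties
open import Data.Product using (Σ-syntax; ∃-syntax; _×_; _,_; proj₁; proj₂)
open import Data.Sum using (_⊎_; inj₁; inj₂)
open import Data.Unit using (⊤; tt)
open import Data.Vec as Vec using (Vec; []; _∷_; lookup; tabulate)
open import Data.Vec.Properties using (lookup∘tabulate)
open import Function using (_∘_)
open import Relation.Binary.PropositionalEquality
open import Relation.Nullary using (¬_; contradiction; Dec; yes; no; does; Reflects; ofʸ; ofⁿ; _×-dec_)
open import Relation.Nullary.Reflects using (¬-reflects; _×-reflects_; _⊎-reflects_; _→-reflects_)

-- A functional language with folds and its compilation to WHILE

infix 9 `_

-- In the body of foldᵗ list init body, variable 0 is the accumulator and
-- variable 1 the list element.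
data Tm : ℕ → Set where
  `_    : ∀ {n} → Fin n → Tm n
  nilᵗ  : ∀ {n} → Tm n
  consᵗ : ∀ {n} → Tm n → Tm n → Tm n
  hdᵗ   : ∀ {n} → Tm n → Tm n
  tlᵗ   : ∀ {n} → Tm n → Tm n
  -- Weakening is a constructor, so terms never have to be renamed: the compiler merely forgets the
  -- register of variable 0.
  wk    : ∀ {n} → Tm n → Tm (suc n)
  letᵗ  : ∀ {n} → Tm n → Tm (suc n) → Tm n
  ifᵗ   : ∀ {n} → Tm n → Tm n → Tm n → Tm n
  foldᵗ : ∀ {n} → Tm n → Tm n → Tm (2 + n) → Tm n

spine : Tree → ℕ
spine nil        = 0
spine (cons _ r) = suc (spine r)

-- Eval M ρ e v : in the environment ρ the term e has the value v, and no fold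
-- met during its evaluation runs over a list longer than M.
data Eval (M : ℕ) : ∀ {n} → Vec Tree n → Tm n → Tree → Set
data Iter (M : ℕ) {n} (ρ : Vec Tree n) (b : Tm (2 + n)) : Tree → Tree → Tree → Set

data Eval M where
  ev-var  : ∀ {n} {ρ : Vec Tree n} i → Eval M ρ (` i) (lookup ρ i)
  ev-nil  : ∀ {n} {ρ : Vec Tree n} → Eval M ρ nilᵗ nil
  ev-cons : ∀ {n} {ρ : Vec Tree n} {e f u v} →
    Eval M ρ e u → Eval M ρ f v → Eval M ρ (consᵗ e f) (cons u v)
  ev-hd   : ∀ {n} {ρ : Vec Tree n} {e v} → Eval M ρ e v → Eval M ρ (hdᵗ e) (hd v)
  ev-tl   : ∀ {n} {ρ : Vec Tree n} {e v} → Eval M ρ e v → Eval M ρ (tlᵗ e) (tl v)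
  ev-wk   : ∀ {n} {ρ : Vec Tree n} {e v x} → Eval M ρ e v → Eval M (x ∷ ρ) (wk e) v
  ev-let  : ∀ {n} {ρ : Vec Tree n} {e f u v} →
    Eval M ρ e u → Eval M (u ∷ ρ) f v → Eval M ρ (letᵗ e f) v
  ev-then : ∀ {n} {ρ : Vec Tree n} {e f g u v} →
    Eval M ρ e u → u ≢ nil → Eval M ρ f v → Eval M ρ (ifᵗ e f g) v
  ev-else : ∀ {n} {ρ : Vec Tree n} {e f g v} →
    Eval M ρ e nil → Eval M ρ g v → Eval M ρ (ifᵗ e f g) v
  ev-fold : ∀ {n} {ρ : Vec Tree n} {e f b l u v} →
    Eval M ρ e l → spine l ≤ M → Eval M ρ f u → Iter M ρ b l u v →
    Eval M ρ (foldᵗ e f b) v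

data Iter M ρ b where
  it-nil  : ∀ {u} → Iter M ρ b nil u u
  it-cons : ∀ {x l u v w} →
    Eval M (u ∷ x ∷ ρ) b v → Iter M ρ b l v w → Iter M ρ b (cons x l) u w

infixr 5 _◂_

_◂_ : ∀ {n} → Var → (Fin n → Var) → Fin (suc n) → Var
(x ◂ r) zero    = x
(x ◂ r) (suc i) = r i

-- Register `m` holds the accumulator, `1 + m` the rest of the list and `2 + m` the current element;
-- the body works from `3 + m` on.
foldLoop : Var → Cmd → Cmd
foldLoop m body =
  while (var (1 + m))
    ((2 + m) ≔ hdᵉ (var (1 + m)) ⨾ body ⨾
     m ≔ var (3 + m) ⨾ (1 + m) ≔ tlᵉ (var (1 + m)))

-- The code for a term reads variable i of the term from r i, leaves its value in
-- m and only writes to variables from m on.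
compile : ∀ {n} → (Fin n → Var) → Var → Tm n → Cmd
compile r m (` i)         = m ≔ var (r i)
compile r m nilᵗ          = m ≔ nilᵉ
compile r m (consᵗ e f)   =
  compile r m e ⨾ compile r (1 + m) f ⨾ m ≔ consᵉ (var m) (var (1 + m))
compile r m (hdᵗ e)       = compile r m e ⨾ m ≔ hdᵉ (var m)
compile r m (tlᵗ e)       = compile r m e ⨾ m ≔ tlᵉ (var m)
compile r m (wk e)        = compile (r ∘ suc) m e
compile r m (letᵗ e f)    =
  compile r m e ⨾ compile (m ◂ r) (1 + m) f ⨾ m ≔ var (1 + m)
-- WHILE has no conditional. Two loops that run at most once replace it: `1 + m` is the flag of the
-- first branch, `2 + m` that of the second, and the first branch clears both.
compile r m (ifᵗ e f g)   =
  compile r (1 + m) e ⨾ (2 + m) ≔ consᵉ nilᵉ nilᵉ ⨾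
  while (var (1 + m))
    (compile r (3 + m) f ⨾ m ≔ var (3 + m) ⨾ (1 + m) ≔ nilᵉ ⨾ (2 + m) ≔ nilᵉ) ⨾
  while (var (2 + m))
    (compile r (3 + m) g ⨾ m ≔ var (3 + m) ⨾ (2 + m) ≔ nilᵉ)
compile r m (foldᵗ e f b) =
  compile r m f ⨾ compile r (1 + m) e ⨾
  foldLoop m (compile (m ◂ 2 + m ◂ r) (3 + m) b)

-- Bounds the time of the compiled code: a copy, a reset to `nil` or a loop test takes 2 units, an
-- assignment with `hdᵉ` or `tlᵉ` 3, one with `consᵉ` 4. A conditional is charged for both branches
-- and a fold for `M` rounds.
cost : ∀ {n} → ℕ → Tm n → ℕ
cost M (` _)         = 2
cost M nilᵗ          = 2
cost M (consᵗ e f)   = cost M e + (cost M f + 4)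
cost M (hdᵗ e)       = cost M e + 3
cost M (tlᵗ e)       = cost M e + 3
cost M (wk e)        = cost M e
cost M (letᵗ e f)    = cost M e + (cost M f + 2)
cost M (ifᵗ e f g)   = cost M e + (4 + ((2 + (cost M f + 6) + 2) + (2 + (cost M g + 4) + 2)))
cost M (foldᵗ e f b) = cost M f + (cost M e + (M * (2 + (3 + (cost M b + 5))) + 2))

-- `coeff` is the value of `cost` at `M = 1`. Degrees of subterms are added where a maximum would
-- do, and each fold contributes one more.
coeff degree : ∀ {n} → Tm n → ℕ
coeff (` _)         = 2
coeff nilᵗ          = 2
coeff (consᵗ e f)   = coeff e + (coeff f + 4)
coeff (hdᵗ e)       = coeff e + 3
coeff (tlᵗ e)       = coeff e + 3
coeff (wk e)        = coeff e
coeff (letᵗ e f)    = coeff e + (coeff f + 2)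
coeff (ifᵗ e f g)   = coeff e + (4 + ((2 + (coeff f + 6) + 2) + (2 + (coeff g + 4) + 2)))
coeff (foldᵗ e f b) = coeff f + (coeff e + ((2 + (3 + (coeff b + 5))) + 2))
degree (` _)         = 0
degree nilᵗ          = 0
degree (consᵗ e f)   = degree e + degree f
degree (hdᵗ e)       = degree e
degree (tlᵗ e)       = degree e
degree (wk e)        = degree e
degree (letᵗ e f)    = degree e + degree f
degree (ifᵗ e f g)   = degree e + (degree f + degree g)
degree (foldᵗ e f b) = degree f + (degree e + suc (degree b))

-- Polynomial bounds on the cost of a term

module _ (M : ℕ) .{{_ : NonZero M}} where

  private
    infix 4 _≼_^^_
    record _≼_^^_ (x a d : ℕ) : Set where
      constructor ⟨_⟩
      field bound : x ≤ a * M ^ d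
    open _≼_^^_

    -- Since `M` is positive, every power of it is at least 1 and absorbs constants.
    const : ∀ c d → c ≼ c ^^ d
    const c d = ⟨ m≤m*n c (M ^ d) {{m^n≢0 M d}} ⟩

    plus : ∀ {x y a b} d → x ≼ a ^^ d → y ≼ b ^^ d → x + y ≼ a + b ^^ d
    plus {a = a} {b} d ⟨ p ⟩ ⟨ q ⟩ =
      ⟨ ≤-trans (+-mono-≤ p q) (≤-reflexive (sym (*-distribʳ-+ (M ^ d) a b))) ⟩

    raise : ∀ {x a d d′} → d ≤ d′ → x ≼ a ^^ d → x ≼ a ^^ d′
    raise {a = a} le ⟨ p ⟩ = ⟨ ≤-trans p (*-monoʳ-≤ a (^-monoʳ-≤ M le)) ⟩

    times : ∀ {x a d} → x ≼ a ^^ d → M * x ≼ a ^^ suc d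
    times {x} {a} {d} ⟨ p ⟩ = ⟨ (begin
      M * x             ≤⟨ *-monoʳ-≤ M p ⟩
      M * (a * M ^ d)   ≡⟨ *-assoc M a (M ^ d) ⟨
      M * a * M ^ d     ≡⟨ cong (_* M ^ d) (*-comm M a) ⟩
      a * M * M ^ d     ≡⟨ *-assoc a M (M ^ d) ⟩
      a * (M * M ^ d)   ∎) ⟩
      where open ≤-Reasoning

    poly : ∀ {n} (e : Tm n) → cost M e ≼ coeff e ^^ degree e
    poly (` _)   = const 2 0
    poly nilᵗ    = const 2 0
    poly (consᵗ e f) = plus D (raise (m≤m+n _ _) (poly e))
      (plus D (raise (m≤n+m _ (degree e)) (poly f)) (const 4 D))
      where D = degree e + degree f
    poly (hdᵗ e) = plus (degree e) (poly e) (const 3 (degree e))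
    poly (tlᵗ e) = plus (degree e) (poly e) (const 3 (degree e))
    poly (wk e)  = poly e
    poly (letᵗ e f) = plus D (raise (m≤m+n _ _) (poly e))
      (plus D (raise (m≤n+m _ (degree e)) (poly f)) (const 2 D))
      where D = degree e + degree f
    poly (ifᵗ e f g) = plus D (raise (m≤m+n _ _) (poly e))
      (plus D (const 4 D) (plus D
        (plus D (plus D (const 2 D) (plus D
          (raise (≤-trans (m≤m+n _ _) (m≤n+m _ (degree e))) (poly f))
          (const 6 D))) (const 2 D))
        (plus D (plus D (const 2 D) (plus D
          (raise (≤-trans (m≤n+m _ (degree f)) (m≤n+m _ (degree e))) (poly g))
          (const 4 D))) (const 2 D))))
      where D = degree e + (degree f + degree g)
    poly (foldᵗ e f b) = plus D (raise (m≤m+n _ _) (poly f))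
      (plus D (raise (≤-trans (m≤m+n _ _) (m≤n+m _ (degree f))) (poly e))
      (plus D (raise (≤-trans (m≤n+m _ (degree e)) (m≤n+m _ (degree f)))
          (times
            (plus d (const 2 d) (plus d (const 3 d) (plus d (poly b) (const 5 d))))))
        (const 2 D)))
      where
      D = degree f + (degree e + suc (degree b))
      d = degree b

  cost-polynomial : ∀ {n} (e : Tm n) → cost M e ≤ coeff e * M ^ degree e
  cost-polynomial e = bound (poly e)

-- Timed total correctness of WHILE commands

cons≢nil : ∀ {a b} → cons a b ≢ nil
cons≢nil ()

-- A total-correctness triple with the time bound `B`. The time is only bounded, because skipped
-- branches and short folds use less than they are charged for.
Runs : Cmd → Store → ℕ → (Store → Set) → Set
Runs c σ B Φ = ∃[ n ] ∃[ τ ] ⟨ c , σ ⟩⇓[ n ] τ × n ≤ B × Φ τ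

runs-seq : ∀ {c d σ A B} {Φ Ψ : Store → Set} → Runs c σ A Φ →
  (∀ {τ} → Φ τ → Runs d τ B Ψ) → Runs (c ⨾ d) σ (A + B) Ψ
runs-seq (_ , _ , p , m≤ , φ) k with k φ
... | _ , _ , q , n≤ , ψ = _ , _ , seq p q , +-mono-≤ m≤ n≤ , ψ

runs-assign : ∀ {x e σ} {Φ : Store → Set} → Φ (σ [ x ↦ ⟦ e ⟧ σ ]) →
  Runs (x ≔ e) σ (1 + time e) Φ
runs-assign φ = _ , _ , assign , ≤-refl , φ

runs-stop : ∀ {e c σ} {Φ : Store → Set} → ⟦ e ⟧ σ ≡ nil → Φ σ →
  Runs (while e c) σ (1 + time e) Φ
runs-stop p φ = _ , _ , while-stop p , ≤-refl , φ

runs-step : ∀ {e c σ A B} {Φ Ψ : Store → Set} → ⟦ e ⟧ σ ≢ nil → Runs c σ A Φ →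
  (∀ {τ} → Φ τ → Runs (while e c) τ B Ψ) → Runs (while e c) σ (1 + time e + A + B) Ψ
runs-step {e} p (_ , _ , q , m≤ , φ) k with k φ
... | _ , _ , r , n≤ , ψ =
  _ , _ , while-step p q r , +-mono-≤ (+-monoʳ-≤ (1 + time e) m≤) n≤ , ψ

runs-weaken : ∀ {c σ A B} {Φ : Store → Set} → A ≤ B → Runs c σ A Φ → Runs c σ B Φ
runs-weaken A≤B (_ , _ , p , n≤ , φ) = _ , _ , p , ≤-trans n≤ A≤B , φ

≡ᵇ-refl : ∀ x → (x ≡ᵇ x) ≡ true
≡ᵇ-refl zero    = refl
≡ᵇ-refl (suc x) = ≡ᵇ-refl x

update-same : ∀ σ x d → (σ [ x ↦ d ]) x ≡ d
update-same σ x d rewrite ≡ᵇ-refl x = refl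

update-below : ∀ σ {x y} d → y < x → (σ [ x ↦ d ]) y ≡ σ y
update-below σ {x} {y} d y<x with y ≡ᵇ x in eq
... | false = refl
... | true  = contradiction (≡ᵇ⇒≡ y x (subst Bool.T (sym eq) tt)) (<⇒≢ y<x)

update-above : ∀ σ {x y} d → x < y → (σ [ x ↦ d ]) y ≡ σ y
update-above σ {x} {y} d x<y with y ≡ᵇ x in eq
... | false = refl
... | true  = contradiction (≡ᵇ⇒≡ y x (subst Bool.T (sym eq) tt)) (>⇒≢ x<y)

Agree : Var → Store → Store → Set
Agree m σ τ = ∀ x → x < m → τ x ≡ σ x

-- The registers of the environment lie below `m`, where code compiled at `m` does not write; hence
-- the environment survives the execution of subterms.
record Holds {n} (r : Fin n → Var) (ρ : Vec Tree n) (m : Var) (σ : Store) : Set where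
  constructor holds
  field at : ∀ i → r i < m × σ (r i) ≡ lookup ρ i

holds-≤ : ∀ {n} {r : Fin n → Var} {ρ m m′ σ τ} → m ≤ m′ → Agree m σ τ →
  Holds r ρ m σ → Holds r ρ m′ τ
holds-≤ m≤ ag (holds h) = holds λ i →
  <-≤-trans (proj₁ (h i)) m≤ , trans (ag _ (proj₁ (h i))) (proj₂ (h i))

holds-◂ : ∀ {n} {r : Fin n → Var} {ρ m x σ v} → x < m → σ x ≡ v →
  Holds r ρ m σ → Holds (x ◂ r) (v ∷ ρ) m σ
holds-◂ x< eq (holds h) = holds λ where
  zero    → x< , eq
  (suc i) → h i

agree-≤ : ∀ {m m′ σ τ} → m ≤ m′ → Agree m′ σ τ → Agree m σ τ
agree-≤ m≤ ag x x< = ag x (<-≤-trans x< m≤)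

agree-trans : ∀ {m σ τ υ} → Agree m σ τ → Agree m τ υ → Agree m σ υ
agree-trans p q x x< = trans (q x x<) (p x x<)

agree-update : ∀ {m x} σ {d} → m ≤ x → Agree m σ (σ [ x ↦ d ])
agree-update σ m≤x y y< = update-below σ _ (<-≤-trans y< m≤x)

1+≤ : ∀ {m} → m ≤ 1 + m
1+≤ = n≤1+n _
2+≤ : ∀ {m} → m ≤ 2 + m
2+≤ = m≤n+m _ 2
3+≤ : ∀ {m} → m ≤ 3 + m
3+≤ = m≤n+m _ 3

agree-last : ∀ {m σ τ} d → Agree m σ τ → Agree m σ (τ [ m ↦ d ])
agree-last d ag = agree-trans ag (agree-update _ ≤-refl)

-- Correctness of the compiler

module _ {M : ℕ} where

  Computes : Var → Store → Tree → Store → Set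
  Computes m σ v τ = τ m ≡ v × Agree m σ τ

  -- The induction is on the evaluation, which supplies the lengths of the folds. `Agree` is the
  -- frame condition that keeps values in lower registers intact while later code runs.
  compile-correct : ∀ {n} {ρ : Vec Tree n} {e v} → Eval M ρ e v →
    ∀ {r m σ} → Holds r ρ m σ → Runs (compile r m e) σ (cost M e) (Computes m σ v)

  -- The time is counted with the actual length `spine l`, as the induction requires; the case of
  -- `foldᵗ` then replaces it by `M`.
  loop-correct : ∀ {n} {ρ : Vec Tree n} {b l u v} → Iter M ρ b l u v →
    ∀ {r m σ} → Holds r ρ m σ → σ m ≡ u → σ (1 + m) ≡ l →
    Runs (foldLoop m (compile (m ◂ 2 + m ◂ r) (3 + m) b)) σ
      (spine l * (2 + (3 + (cost M b + 5))) + 2) (Computes m σ v)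

  compile-correct (ev-var i) {m = m} {σ} (holds h) =
    runs-assign (trans (update-same σ m _) (proj₂ (h i)) , agree-update σ ≤-refl)
  compile-correct ev-nil {m = m} {σ} h =
    runs-assign (update-same σ m _ , agree-update σ ≤-refl)
  compile-correct (ev-cons d d′) {m = m} h =
    runs-seq (compile-correct d h) λ (p , ag) →
    runs-seq (compile-correct d′ (holds-≤ 1+≤ ag h)) λ {τ} (q , ag′) →
    runs-assign
      ( trans (update-same τ m _) (cong₂ cons (trans (ag′ _ ≤-refl) p) q)
      , agree-last _ (agree-trans ag (agree-≤ 1+≤ ag′)))
  compile-correct (ev-hd d) {m = m} h =
    runs-seq (compile-correct d h) λ {τ} (p , ag) →
    runs-assign (trans (update-same τ m _) (cong hd p) , agree-last _ ag)
  compile-correct (ev-tl d) {m = m} h =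
    runs-seq (compile-correct d h) λ {τ} (p , ag) →
    runs-assign (trans (update-same τ m _) (cong tl p) , agree-last _ ag)
  compile-correct (ev-wk d) (holds h) = compile-correct d (holds (h ∘ suc))
  compile-correct (ev-let d d′) {m = m} h =
    runs-seq (compile-correct d h) λ (p , ag) →
    runs-seq (compile-correct d′ (holds-◂ ≤-refl p (holds-≤ 1+≤ ag h))) λ {τ} (q , ag′) →
    runs-assign (trans (update-same τ m _) q , agree-last _ (agree-trans ag (agree-≤ 1+≤ ag′)))
  compile-correct (ev-then {f = f} {g} {u} d u≢nil d′) {m = m} {σ} h =
    runs-seq (compile-correct d (holds-≤ 1+≤ (λ _ _ → refl) h)) λ {τ} (p , ag) →
    runs-seq (runs-assign {Φ = λ τ → τ (1 + m) ≡ u × Agree m σ τ}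
      ( trans (update-below τ _ ≤-refl) p
      , agree-trans (agree-≤ 1+≤ ag) (agree-update τ 2+≤))) λ (p , ag) →
    runs-seq
      -- The body clears both flags, so this loop stops after one round and the next one is never
      -- entered.
      (runs-step (λ q → u≢nil (trans (sym p) q))
        (runs-seq (compile-correct d′ (holds-≤ 3+≤ ag h)) λ {τ} (q , ag′) →
         runs-seq (runs-assign {Φ = Computes m σ _}
           (trans (update-same τ m _) q , agree-last _ (agree-trans ag (agree-≤ 3+≤ ag′))))
           λ {τ} (q , ag) →
         runs-seq (runs-assign {Φ = λ τ → Computes m σ _ τ × τ (1 + m) ≡ nil}
           ( (trans (update-below τ _ ≤-refl) q , agree-trans ag (agree-update τ 1+≤))
           , update-same τ (1 + m) _)) λ {τ} ((q , ag) , z) →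
         runs-assign {Φ = λ τ → (Computes m σ _ τ × τ (1 + m) ≡ nil) × τ (2 + m) ≡ nil}
           ( ( (trans (update-below τ _ 1+≤) q , agree-trans ag (agree-update τ 2+≤))
             , trans (update-below τ _ ≤-refl) z)
           , update-same τ (2 + m) _))
        λ ((c , z) , z′) → runs-stop {Φ = λ τ → Computes m σ _ τ × τ (2 + m) ≡ nil} z (c , z′))
      λ (c , z) → runs-weaken (m≤n+m 2 (2 + (cost M g + 4))) (runs-stop z c)
  compile-correct (ev-else {f = f} {g} d d′) {m = m} {σ} h =
    runs-seq (compile-correct d (holds-≤ 1+≤ (λ _ _ → refl) h)) λ {τ} (p , ag) →
    runs-seq (runs-assign {Φ = λ τ → (τ (1 + m) ≡ nil × τ (2 + m) ≡ cons nil nil) × Agree m σ τ}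
      ( (trans (update-below τ _ ≤-refl) p , update-same τ (2 + m) _)
      , agree-trans (agree-≤ 1+≤ ag) (agree-update τ 2+≤))) λ ((p , p′) , ag) →
    runs-seq
      (runs-weaken (m≤n+m 2 (2 + (cost M f + 6)))
        (runs-stop {Φ = λ τ → τ (2 + m) ≡ cons nil nil × Agree m σ τ} p (p′ , ag)))
      λ (p , ag) →
      runs-step (λ q → cons≢nil (trans (sym p) q))
        (runs-seq (compile-correct d′ (holds-≤ 3+≤ ag h)) λ {τ} (q , ag′) →
         runs-seq (runs-assign {Φ = Computes m σ _}
           (trans (update-same τ m _) q , agree-last _ (agree-trans ag (agree-≤ 3+≤ ag′))))
           λ {τ} (q , ag) →
         runs-assign {Φ = λ τ → Computes m σ _ τ × τ (2 + m) ≡ nil}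
           ( (trans (update-below τ _ 1+≤) q , agree-trans ag (agree-update τ 2+≤))
           , update-same τ (2 + m) _))
        λ (c , z) → runs-stop z c
  compile-correct (ev-fold {b = b} {l} d l≤M d′ it) {m = m} {σ} h =
    runs-seq (compile-correct d′ h) λ (p , ag) →
    runs-seq (compile-correct d (holds-≤ 1+≤ ag h)) λ {τ} (q , ag′) →
    let ag″ = agree-trans ag (agree-≤ 1+≤ ag′)
        (n , υ , run , n≤ , r , ag‴) = loop-correct it (holds-≤ ≤-refl ag″ h) (trans (ag′ _ ≤-refl) p) q
    in n , υ , run
     , ≤-trans n≤ (+-monoˡ-≤ 2 (*-monoˡ-≤ (2 + (3 + (cost M b + 5))) l≤M))
     , r , agree-trans ag″ ag‴

  loop-correct it-nil h p q = runs-stop q (p , λ _ _ → refl)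
  loop-correct {b = b} (it-cons {x} {l} {u} {v} d it) {r} {m} {σ} h p q =
    runs-weaken (≤-reflexive (sym (+-assoc (2 + (3 + (cost M b + 5))) _ 2)))
      (runs-step (λ z → cons≢nil (trans (sym q) z))
        (runs-seq (runs-assign {Φ = λ τ → τ (2 + m) ≡ x × Agree (2 + m) σ τ}
          ( trans (update-same σ (2 + m) _) (cong hd q)
          , agree-update σ ≤-refl)) λ (y , ag) →
         runs-seq (compile-correct d
           (holds-◂ (m≤n+m _ 2) (trans (ag _ 1+≤) p)
             (holds-◂ ≤-refl y (holds-≤ 3+≤ (agree-≤ 2+≤ ag) h)))) λ {τ} (y , ag′) →
         runs-seq (runs-assign {Φ = λ τ → Computes m σ v τ × τ (1 + m) ≡ cons x l}
           ( (trans (update-same τ m _) y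
             , agree-last _ (agree-trans (agree-≤ 2+≤ ag) (agree-≤ 3+≤ ag′)))
           , trans (update-above τ _ ≤-refl) (trans (ag′ _ 1+≤) (trans (ag _ ≤-refl) q))))
           λ {τ} ((y , ag) , z) →
         runs-assign {Φ = λ τ → Computes m σ v τ × τ (1 + m) ≡ l}
           ( (trans (update-below τ _ ≤-refl) y , agree-trans ag (agree-update τ 1+≤))
           , trans (update-same τ (1 + m) _) (cong tl z)))
        λ ((y , ag) , z) →
          let (n , υ , run , n≤ , e , ag′) = loop-correct it (holds-≤ ≤-refl ag h) y z
          in n , υ , run , n≤ , e , agree-trans ag ag′)

-- Decision procedures in the functional language

-- Joins the correctness of the answer with the bound `M` on the folds, from which the running time
-- follows.
Decides : ∀ {n} → ℕ → Vec Tree n → Tm n → Set → Set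
Decides M ρ e P = ∃[ b ] Eval M ρ e (encodeBool b) × Reflects P b

reflects-map : ∀ {P Q : Set} {b} → (P → Q) → (Q → P) → Reflects P b → Reflects Q b
reflects-map to from (ofʸ p)  = ofʸ (to p)
reflects-map to from (ofⁿ ¬p) = ofⁿ (¬p ∘ from)

trueᵗ : ∀ {n} → Tm n
trueᵗ = consᵗ nilᵗ nilᵗ

notᵗ : ∀ {n} → Tm n → Tm n
notᵗ e = ifᵗ e nilᵗ trueᵗ

andᵗ orᵗ impᵗ : ∀ {n} → Tm n → Tm n → Tm n
andᵗ e f = ifᵗ e f nilᵗ
orᵗ  e f = ifᵗ e trueᵗ f
impᵗ e f = ifᵗ e f trueᵗ

-- The conjunction is written out `k` times without a fold. This is possible because `k` is a
-- constant of the program; it only affects `coeff` and `degree`.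
allᵗ : ∀ {n} k → (Fin k → Tm n) → Tm n
allᵗ zero    f = trueᵗ
allᵗ (suc k) f = andᵗ (f zero) (allᵗ k (f ∘ suc))

-- In `φ` variable 0 is the list element; `wk` hides the accumulator from it. Filtering reverses the
-- order, but the lists only serve as sets.
anyᵗ filterᵗ : ∀ {n} → Tm n → Tm (suc n) → Tm n
anyᵗ    l φ = foldᵗ l nilᵗ (ifᵗ (wk φ) trueᵗ (` zero))
filterᵗ l φ = foldᵗ l nilᵗ (ifᵗ (wk φ) (consᵗ (` suc zero) (` zero)) (` zero))

-- Dropping x cells from the unary numeral 1 + y leaves the numeral 1 exactly if
-- x = y.
eqᵗ : ∀ {n} → Tm n → Tm n → Tm n
eqᵗ x y = letᵗ (foldᵗ x (consᵗ nilᵗ y) (tlᵗ (` zero)))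
  (ifᵗ (` zero) (notᵗ (tlᵗ (` zero))) nilᵗ)

nthᵗ : ∀ {n k} → Fin k → Tm n → Tm n
nthᵗ zero    e = hdᵗ e
nthᵗ (suc i) e = nthᵗ i (tlᵗ e)

encodeAll : {A : Set} → (A → Tree) → List A → Tree
encodeAll f xs = encodeList (map f xs)

spine-encodeAll : {A : Set} (f : A → Tree) (xs : List A) → spine (encodeAll f xs) ≡ length xs
spine-encodeAll f []       = refl
spine-encodeAll f (x ∷ xs) = cong suc (spine-encodeAll f xs)

spine-encodeℕ : ∀ n → spine (encodeℕ n) ≡ n
spine-encodeℕ zero    = refl
spine-encodeℕ (suc n) = cong suc (spine-encodeℕ n)

-- Correctness of the decision procedures

module _ {M n : ℕ} {ρ : Vec Tree n} where

  ev-true : Eval M ρ trueᵗ (encodeBool true)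
  ev-true = ev-cons ev-nil ev-nil

  decides-map : ∀ {e P Q} → (P → Q) → (Q → P) → Decides M ρ e P → Decides M ρ e Q
  decides-map to from (b , d , r) = b , d , reflects-map to from r

  decides-true : ∀ {P} → P → Decides M ρ trueᵗ P
  decides-true p = true , ev-true , ofʸ p

  decides-constant : ∀ {P} (P? : Dec P) → Decides M ρ (if does P? then trueᵗ else nilᵗ) P
  decides-constant (yes p) = true , ev-true , ofʸ p
  decides-constant (no ¬p) = false , ev-nil , ofⁿ ¬p

  decides-not : ∀ {e P} → Decides M ρ e P → Decides M ρ (notᵗ e) (¬ P)
  decides-not (true  , d , r) = false , ev-then d cons≢nil ev-nil , ¬-reflects r
  decides-not (false , d , r) = true , ev-else d ev-true , ¬-reflects r

  decides-and : ∀ {e f P Q} → Decides M ρ e P → Decides M ρ f Q → Decides M ρ (andᵗ e f) (P × Q)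
  decides-and (true  , d , r) (b , d′ , r′) = b , ev-then d cons≢nil d′ , (r ×-reflects r′)
  decides-and (false , d , r) (_ , _  , r′) = false , ev-else d ev-nil , (r ×-reflects r′)

  decides-or : ∀ {e f P Q} → Decides M ρ e P → Decides M ρ f Q → Decides M ρ (orᵗ e f) (P ⊎ Q)
  decides-or (true  , d , r) (_ , _  , r′) = true , ev-then d cons≢nil ev-true , (r ⊎-reflects r′)
  decides-or (false , d , r) (b , d′ , r′) = b , ev-else d d′ , (r ⊎-reflects r′)

  decides-imp : ∀ {e f P Q} → Decides M ρ e P → Decides M ρ f Q → Decides M ρ (impᵗ e f) (P → Q)
  decides-imp (true  , d , r) (b , d′ , r′) = b , ev-then d cons≢nil d′ , (r →-reflects r′)
  decides-imp (false , d , r) (_ , _  , r′) = true , ev-else d ev-true , (r →-reflects r′)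

  decides-all : ∀ k {f : Fin k → Tm n} {P : Fin k → Set} →
    (∀ i → Decides M ρ (f i) (P i)) → Decides M ρ (allᵗ k f) (∀ i → P i)
  decides-all zero    d = decides-true λ ()
  decides-all (suc k) d = decides-map
    (λ (p , q) → λ { zero → p ; (suc i) → q i }) (λ p → p zero , p ∘ suc)
    (decides-and (d zero) (decides-all k (d ∘ suc)))

  ev-nth : ∀ {A : Set} {f : A → Tree} {k e} {v : Vec A k} (i : Fin k) →
    Eval M ρ e (encodeAll f (Vec.toList v)) → Eval M ρ (nthᵗ i e) (f (lookup v i))
  ev-nth {v = _ ∷ _} zero d = ev-hd d
  ev-nth {f = f} {v = _ ∷ v} (suc i) d = ev-nth {f = f} {v = v} i (ev-tl d)

  private
    -- As `tl nil` is `nil`, iterating `tl` computes truncated subtraction.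
    drop-cells : ∀ x z → Iter M ρ (tlᵗ (` zero)) (encodeℕ x) (encodeℕ z) (encodeℕ (z ∸ x))
    drop-cells zero    z       = it-nil
    drop-cells (suc x) zero    = it-cons (ev-tl (ev-var zero))
      (subst (λ z → Iter M ρ (tlᵗ (` zero)) (encodeℕ x) nil (encodeℕ z)) (0∸n≡0 x) (drop-cells x zero))
    drop-cells (suc x) (suc z) = it-cons (ev-tl (ev-var zero)) (drop-cells x z)

  decides-eq : ∀ {e f x y} → Eval M ρ e (encodeℕ x) → Eval M ρ f (encodeℕ y) → x ≤ M →
    Decides M ρ (eqᵗ e f) (x ≡ y)
  decides-eq {e} {f} {x} {y} d d′ x≤M = finish (suc y ∸ x) refl
    where
    restᵗ = foldᵗ e (consᵗ nilᵗ f) (tlᵗ (` zero))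

    rest : Eval M ρ restᵗ (encodeℕ (suc y ∸ x))
    rest = ev-fold d (subst (_≤ M) (sym (spine-encodeℕ x)) x≤M) (ev-cons ev-nil d′)
      (drop-cells x (suc y))

    cells-left-1 : ∀ x y → suc y ∸ x ≡ 1 → x ≡ y
    cells-left-1 zero    zero    _ = refl
    cells-left-1 (suc x) zero    p with () ← trans (sym (0∸n≡0 x)) p
    cells-left-1 (suc x) (suc y) p = cong suc (cells-left-1 x y p)

    -- No cell is left if `x` exceeds `y`, exactly one if they are equal, and at least two if `x` is
    -- smaller.
    finish : ∀ z → suc y ∸ x ≡ z → Decides M ρ (eqᵗ e f) (x ≡ y)
    finish z eq with subst (Eval M ρ restᵗ ∘ encodeℕ) eq rest
    finish zero eq | r =
      false , ev-let r (ev-else (ev-var zero) ev-nil) ,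
      ofⁿ λ { refl → contradiction (trans (sym (m+n∸n≡m 1 x)) eq) λ () }
    finish (suc zero) eq | r =
      true ,
      ev-let r (ev-then (ev-var zero) cons≢nil (ev-else (ev-tl (ev-var zero)) (ev-cons ev-nil ev-nil))) ,
      ofʸ (cells-left-1 x y eq)
    finish (suc (suc z)) eq | r =
      false , ev-let r (ev-then (ev-var zero) cons≢nil (ev-then (ev-tl (ev-var zero)) cons≢nil ev-nil)) ,
      ofⁿ λ { refl → contradiction (trans (sym (m+n∸n≡m 1 x)) eq) λ () }

  ev-foldList : ∀ {A : Set} {f : A → Tree} {xs : List A} {l e b u v} →
    Eval M ρ l (encodeAll f xs) → length xs ≤ M → Eval M ρ e u →
    Iter M ρ b (encodeAll f xs) u v → Eval M ρ (foldᵗ l e b) v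
  ev-foldList {f = f} {xs} d xs≤M =
    ev-fold d (subst (_≤ M) (sym (spine-encodeAll f xs)) xs≤M)

  decides-if : ∀ {e f g P Q} → Decides M ρ e P → (P → Decides M ρ f Q) → (¬ P → Decides M ρ g Q) →
    Decides M ρ (ifᵗ e f g) Q
  decides-if (true  , d , ofʸ p)  k _ = let (b , d′ , r) = k p  in b , ev-then d cons≢nil d′ , r
  decides-if (false , d , ofⁿ ¬p) _ k = let (b , d′ , r) = k ¬p in b , ev-else d d′ , r

  decides-let : ∀ {e f v P} → Eval M ρ e v → Decides M (v ∷ ρ) f P → Decides M ρ (letᵗ e f) P
  decides-let d (b , d′ , r) = b , ev-let d d′ , r

  module _ {A : Set} {f : A → Tree} {P : A → Set} {φ : Tm (suc n)}
    (d : ∀ x → Decides M (f x ∷ ρ) φ (P x)) where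

    private
      -- For the induction the accumulator may reflect any proposition `Q`, which stands for the
      -- part of the list already read.
      iter-any : ∀ {Q} xs b → Reflects Q b → ∃[ b′ ]
        Iter M ρ (ifᵗ (wk φ) trueᵗ (` zero)) (encodeAll f xs) (encodeBool b) (encodeBool b′) ×
        Reflects (Q ⊎ Any P xs) b′
      iter-any []       b r = b , it-nil , reflects-map inj₁ (λ { (inj₁ q) → q ; (inj₂ ()) }) r
      iter-any (x ∷ xs) b r with d x
      ... | true , e , ofʸ p =
        let (b′ , it , r′) = iter-any xs true (ofʸ p)
        in b′ , it-cons (ev-then (ev-wk e) cons≢nil (ev-cons ev-nil ev-nil)) it ,
           reflects-map (λ { (inj₁ p) → inj₂ (here p) ; (inj₂ q) → inj₂ (there q) })
             (λ { (inj₁ _) → inj₁ p ; (inj₂ (here p)) → inj₁ p ; (inj₂ (there q)) → inj₂ q }) r′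
      ... | false , e , ofⁿ ¬p =
        let (b′ , it , r′) = iter-any xs b r
        in b′ , it-cons (ev-else (ev-wk e) (ev-var zero)) it ,
           reflects-map (λ { (inj₁ q) → inj₁ q ; (inj₂ q) → inj₂ (there q) })
             (λ { (inj₁ q) → inj₁ q ; (inj₂ (here p)) → contradiction p ¬p
                ; (inj₂ (there q)) → inj₂ q }) r′

      -- The accumulator `ys` is arbitrary for the induction. The bound on the length is what allows
      -- a fold over the filtered list later.
      iter-filter : ∀ xs ys → ∃[ zs ]
        Iter M ρ (ifᵗ (wk φ) (consᵗ (` suc zero) (` zero)) (` zero))
          (encodeAll f xs) (encodeAll f ys) (encodeAll f zs) ×
        length zs ≤ length xs + length ys ×
        (∀ {z} → z ∈ zs → z ∈ ys ⊎ (z ∈ xs × P z)) ×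
        (∀ {z} → z ∈ ys ⊎ (z ∈ xs × P z) → z ∈ zs)
      iter-filter []       ys = ys , it-nil , ≤-refl , inj₁ , λ { (inj₁ q) → q ; (inj₂ (() , _)) }
      iter-filter (x ∷ xs) ys with d x
      ... | true , e , ofʸ p =
        let (zs , it , len , to , from) = iter-filter xs (x ∷ ys)
        in zs ,
           it-cons (ev-then (ev-wk e) cons≢nil (ev-cons (ev-var (suc zero)) (ev-var zero))) it ,
           ≤-trans len (≤-reflexive (+-suc (length xs) (length ys))) ,
           (λ z∈ → case₁ p (to z∈)) , (from ∘ case₂)
        where
        case₁ : ∀ {z} → P x → z ∈ x ∷ ys ⊎ (z ∈ xs × P z) → z ∈ ys ⊎ (z ∈ x ∷ xs × P z)
        case₁ p (inj₁ (here refl))  = inj₂ (here refl , p)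
        case₁ p (inj₁ (there z∈))   = inj₁ z∈
        case₁ p (inj₂ (z∈ , q))     = inj₂ (there z∈ , q)
        case₂ : ∀ {z} → z ∈ ys ⊎ (z ∈ x ∷ xs × P z) → z ∈ x ∷ ys ⊎ (z ∈ xs × P z)
        case₂ (inj₁ z∈)               = inj₁ (there z∈)
        case₂ (inj₂ (here refl , q))  = inj₁ (here refl)
        case₂ (inj₂ (there z∈ , q))   = inj₂ (z∈ , q)
      ... | false , e , ofⁿ ¬p =
        let (zs , it , len , to , from) = iter-filter xs ys
        in zs , it-cons (ev-else (ev-wk e) (ev-var zero)) it , m≤n⇒m≤1+n len ,
           (λ z∈ → case₁ (to z∈)) , (from ∘ case₂)
        where
        case₁ : ∀ {z} → z ∈ ys ⊎ (z ∈ xs × P z) → z ∈ ys ⊎ (z ∈ x ∷ xs × P z)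
        case₁ (inj₁ z∈)       = inj₁ z∈
        case₁ (inj₂ (z∈ , q)) = inj₂ (there z∈ , q)
        case₂ : ∀ {z} → z ∈ ys ⊎ (z ∈ x ∷ xs × P z) → z ∈ ys ⊎ (z ∈ xs × P z)
        case₂ (inj₁ z∈)              = inj₁ z∈
        case₂ (inj₂ (here refl , q)) = contradiction q ¬p
        case₂ (inj₂ (there z∈ , q))  = inj₂ (z∈ , q)

    decides-any : ∀ {l xs} → Eval M ρ l (encodeAll f xs) → length xs ≤ M →
      Decides M ρ (anyᵗ l φ) (∃[ x ] x ∈ xs × P x)
    decides-any {xs = xs} e xs≤M =
      let (b , it , r) = iter-any xs false (ofⁿ λ p → p)
      in b , ev-foldList {f = f} {xs} e xs≤M ev-nil it ,
         reflects-map (λ { (inj₁ ()) ; (inj₂ q) → find q }) (λ (_ , x∈ , p) → inj₂ (lose x∈ p)) r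

    ev-filter : ∀ {l xs} → Eval M ρ l (encodeAll f xs) → length xs ≤ M → ∃[ ys ]
      Eval M ρ (filterᵗ l φ) (encodeAll f ys) × length ys ≤ length xs ×
      (∀ {y} → y ∈ ys → y ∈ xs × P y) × (∀ {y} → y ∈ xs → P y → y ∈ ys)
    ev-filter {xs = xs} e xs≤M =
      let (ys , it , len , to , from) = iter-filter xs []
      in ys , ev-foldList {f = f} {xs} e xs≤M ev-nil it ,
         subst (length ys ≤_) (+-identityʳ _) len ,
         (λ y∈ → strip (to y∈)) , λ y∈ p → from (inj₂ (y∈ , p))
      where
      strip : ∀ {y} → y ∈ [] ⊎ (y ∈ xs × P y) → y ∈ xs × P y
      strip (inj₁ ())
      strip (inj₂ q) = q

-- From terms to polynomial time

^-distribʳ-* : ∀ d m n → (m * n) ^ d ≡ m ^ d * n ^ d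
^-distribʳ-* zero    m n = refl
^-distribʳ-* (suc d) m n = trans (cong (m * n *_) (^-distribʳ-* d m n))
  ([m*n]*[o*p]≡[m*o]*[n*p] m n (m ^ d) (n ^ d))

-- For positive `n` use `1 + n ≤ 2 * n`; for `n = 0` the additive constant suffices.
1+n^d≤ : ∀ n d → (1 + n) ^ d ≤ 2 ^ d * n ^ d + 2 ^ d
1+n^d≤ zero    d = begin
  1 ^ d                   ≤⟨ ^-monoˡ-≤ d (s≤s z≤n) ⟩
  2 ^ d                   ≤⟨ m≤n+m _ _ ⟩
  2 ^ d * 0 ^ d + 2 ^ d   ∎
  where open ≤-Reasoning
1+n^d≤ n@(suc n′) d = begin
  (1 + n) ^ d             ≤⟨ ^-monoˡ-≤ d (+-mono-≤ (s≤s (z≤n {n′})) (m≤m+n n 0)) ⟩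
  (2 * n) ^ d             ≡⟨ ^-distribʳ-* d 2 n ⟩
  2 ^ d * n ^ d           ≤⟨ m≤m+n _ _ ⟩
  2 ^ d * n ^ d + 2 ^ d   ∎
  where open ≤-Reasoning

term⇒polynomialTime : {I : Set} (encode : I → Tree) (size : I → ℕ) (Q : I → Set) (e : Tm 1) (m : ℕ) →
  (∀ i → Decides ((1 + size i) ^ m) (encode i ∷ []) e (Q i)) →
  DecidableInPolynomialTime encode size Q
term⇒polynomialTime {I} encode size Q e m dec = program , c , E , λ i →
  let (b , d , r) = dec i
      (n , τ , run , n≤ , out) = runs (encode i) d
  in n , τ , b , run , ≤-trans n≤ (bound (size i)) , out , r
  where
  -- The input occupies register 0, so the term computes from register 1 on, and the result is
  -- copied back in 2 time units, which `C` includes.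
  program = compile (λ _ → 0) 1 e ⨾ 0 ≔ var 1
  E = m * degree e
  C = coeff e + 2
  c = C * 2 ^ E

  runs : ∀ x {M v} → Eval M (x ∷ []) e v →
    Runs program (input x) (cost M e + 2) (λ τ → output τ ≡ v)
  runs x d =
    runs-seq (compile-correct d (holds λ { zero → s≤s z≤n , refl })) λ (p , _) →
    runs-assign p

  bound : ∀ N → cost ((1 + N) ^ m) e + 2 ≤ c * N ^ E + c
  bound N = begin
    cost ((1 + N) ^ m) e + 2
      ≤⟨ +-mono-≤ (cost-polynomial ((1 + N) ^ m) {{m^n≢0 (1 + N) m}} e)
           (m≤m*n 2 (((1 + N) ^ m) ^ degree e) {{m^n≢0 ((1 + N) ^ m) (degree e) {{m^n≢0 (1 + N) m}}}}) ⟩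
    coeff e * ((1 + N) ^ m) ^ degree e + 2 * ((1 + N) ^ m) ^ degree e
      ≡⟨ *-distribʳ-+ (((1 + N) ^ m) ^ degree e) (coeff e) 2 ⟨
    C * ((1 + N) ^ m) ^ degree e
      ≡⟨ cong (C *_) (^-*-assoc (1 + N) m (degree e)) ⟩
    C * (1 + N) ^ E
      ≤⟨ *-monoʳ-≤ C (1+n^d≤ N E) ⟩
    C * (2 ^ E * N ^ E + 2 ^ E)
      ≡⟨ *-distribˡ-+ C (2 ^ E * N ^ E) (2 ^ E) ⟩
    C * (2 ^ E * N ^ E) + c
      ≡⟨ cong (_+ c) (*-assoc C (2 ^ E) (N ^ E)) ⟨
    c * N ^ E + c ∎
    where open ≤-Reasoning

-- Paths and tokens in an acyclic digraph

lookup-injective : {A : Set} {xs : List A} → Unique xs →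
  ∀ i j → List.lookup xs i ≡ List.lookup xs j → i ≡ j
lookup-injective (_ ∷ _)   zero    zero    _  = refl
lookup-injective (x∉ ∷ _)  zero    (suc j) eq = contradiction eq (All.lookup x∉ (∈-lookup j))
lookup-injective (x∉ ∷ _)  (suc i) zero    eq = contradiction (sym eq) (All.lookup x∉ (∈-lookup i))
lookup-injective (_ ∷ uniq) (suc i) (suc j) eq = cong suc (lookup-injective uniq i j eq)

-- The pigeonhole principle, applied to the map from positions to entries.
unique⇒length≤ : ∀ {n} {xs : List (Fin n)} → Unique xs → length xs ≤ n
unique⇒length≤ uniq = Fin.injective⇒≤ (lookup-injective uniq _ _)

module _ (G : Digraph) where
  open Digraph G

  walk-∷ʳ : ∀ {u as} a → IsWalk G u (src a) as → IsWalk G u (tgt a) (as ∷ʳ a)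
  walk-∷ʳ {as = []}    a eq       = sym eq , refl
  walk-∷ʳ {as = _ ∷ _} a (eq , w) = eq , walk-∷ʳ a w

  src-visited : ∀ {u w as a} → IsWalk G u w as → a ∈ as → src a ∈ u ∷ map tgt as
  src-visited (eq , _) (here refl) = here eq
  src-visited (_ , w)  (there a∈)  = there (src-visited w a∈)

  end-visited : ∀ {u w} a as → IsWalk G u w (a ∷ as) → w ∈ map tgt (a ∷ as)
  end-visited a []       (_ , refl) = here refl
  end-visited a (b ∷ bs) (_ , w)    = there (end-visited b bs w)

  -- The last component says that the vertices of bs are among those of as; it
  -- makes the induction go through.
  cut : ∀ {u w x as} → IsWalk G u w as → Unique (map tgt as) → x ∈ map tgt as →
    ∃[ bs ] IsWalk G u x bs × bs ≢ [] × Unique (map tgt bs) ×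
      (∀ {P : Vertex → Set} → All P (map tgt as) → All P (map tgt bs))
  cut {as = a ∷ as} (eq , w) _          (here refl) =
    a ∷ [] , (eq , refl) , (λ ()) , ([] ∷ []) , λ { (p ∷ _) → p ∷ [] }
  cut {as = a ∷ as} (eq , w) (a∉ ∷ uniq) (there x∈) =
    let (bs , w′ , _ , uniq′ , all) = cut w uniq x∈
    in a ∷ bs , (eq , w′) , (λ ()) , (all a∉ ∷ uniq′) , λ { (p ∷ ps) → p ∷ all ps }

  module _ (acyclic : Acyclic G) where

    -- The vertices after the first are distinct by induction. If the first one recurred among them,
    -- cutting the walk there would leave a cycle.
    walk⇒unique : ∀ {u w} as → IsWalk G u w as → Unique (u ∷ map tgt as)
    walk⇒unique []       _            = [] ∷ []
    walk⇒unique {u} as@(a ∷ as′) walk@(_ , w) = All.tabulate distinct ∷ uniq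
      where
      uniq : Unique (map tgt as)
      uniq = walk⇒unique as′ w
      distinct : ∀ {x} → x ∈ map tgt as → u ≢ x
      distinct x∈ refl =
        let (bs , w′ , nonempty , uniq′ , _) = cut walk uniq x∈
        in acyclic u bs (w′ , nonempty , uniq′)

    walk⇒path : ∀ {u w as} → IsWalk G u w as → IsPath G u w as
    walk⇒path w = w , walk⇒unique _ w

    walk-length : ∀ {u w as} → IsWalk G u w as → length as < #V
    walk-length {as = as} w = subst (_< #V) (length-map tgt as) (unique⇒length≤ (walk⇒unique as w))

    closed-walk-empty : ∀ {u as} → IsWalk G u u as → as ≡ []
    closed-walk-empty {as = []}     _ = refl
    closed-walk-empty {as = a ∷ as} w with walk⇒unique (a ∷ as) w
    ... | u∉ ∷ _ = contradiction refl (All.lookup u∉ (end-visited a as w))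

    -- Further along, the arc would make the walk visit `s` again. So it comes first, and what
    -- follows it is a closed walk at `t`, hence empty.
    st-arc-path : ∀ {s t as a} → IsWalk G s t as → a ∈ as → src a ≡ s → tgt a ≡ t → as ≡ a ∷ []
    st-arc-path {as = a ∷ as} (_ , w) (here refl) _ refl = cong (a ∷_) (closed-walk-empty w)
    st-arc-path {as = a ∷ as} W@(_ , w) (there a∈) refl _ with walk⇒unique (a ∷ as) W
    ... | s∉ ∷ _ = contradiction refl (All.lookup s∉ (src-visited w a∈))

  -- Levels of arcs

  Level : ℕ → Arc → Set
  Level zero    b = ⊤
  Level (suc r) b = ∃[ a ] Level r a × tgt a ≡ src b

  level? : ∀ r a → Dec (Level r a)
  level? zero    b = yes tt
  level? (suc r) b = Fin.any? λ a → level? r a ×-dec tgt a Fin.≟ src b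

  -- Drop the first arc of the walk. So the levels form a decreasing chain.
  level-suc : ∀ r {a} → Level (suc r) a → Level r a
  level-suc zero    _            = tt
  level-suc (suc r) (a , l , eq) = a , level-suc r l , eq

  level⇒walk : ∀ r {a} → Level r a → ∃[ u ] ∃[ as ] IsWalk G u (tgt a) as × length as ≡ suc r
  level⇒walk zero    {a} _ = src a , a ∷ [] , (refl , refl) , refl
  level⇒walk (suc r) {a} (b , l , eq) =
    let (u , as , w , len) = level⇒walk r l
    in u , as ∷ʳ a , walk-∷ʳ a (subst (λ v → IsWalk G u v as) eq w) ,
       trans (length-++ as) (trans (+-comm (length as) 1) (cong suc len))

  -- Such an arc would end a walk of `1 + #V` arcs, while a walk in an acyclic digraph has fewer
  -- than `#V`.
  level-#V-empty : Acyclic G → ∀ {a} → ¬ Level #V a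
  level-#V-empty acyclic l =
    let (_ , _ , w , len) = level⇒walk #V l
    in <-asym (walk-length acyclic w) (≤-reflexive (sym len))

  -- The token game, and walks from token runs

  module _ (s t : Vertex) {k : ℕ} (g : Fin k → Fin k → Arc) where

    MayShare : Fin k → Fin k → Arc → Set
    MayShare i j a = a ≡ g i j × ¬ (src a ≡ s × tgt a ≡ t)

    Valid : Vec Arc k → Set
    Valid u = ∀ i j → i ≢ j → lookup u i ≡ lookup u j → MayShare i j (lookup u i)

    Start Final : Vec Arc k → Set
    Start u = ∀ i → src (lookup u i) ≡ s
    Final u = ∀ i → tgt (lookup u i) ≡ t

    -- A token may rest in any round. Since levels decrease, an arc can be left only in the last
    -- round whose level contains it; a token that misses this round stays for good.
    Moves : ℕ → Arc → Arc → Set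
    Moves r a b = a ≡ b ⊎ (Level r a × ¬ Level (suc r) a × tgt a ≡ src b)

    Step : ℕ → Vec Arc k → Vec Arc k → Set
    Step r u u′ = ∀ i → Moves r (lookup u i) (lookup u′ i)

    Reach : ℕ → Vec Arc k → Set
    Reach zero    u  = Valid u × Start u
    Reach (suc r) u′ = Valid u′ × ∃[ u ] Reach r u × Step r u u′

    reach-valid : ∀ r {u} → Reach r u → Valid u
    reach-valid zero    = proj₁
    reach-valid (suc r) = proj₁

    WalkSystem : (Fin k → List Arc) → Set
    WalkSystem p = (∀ i → IsWalk G s t (p i)) ×
      (∀ i j → i ≢ j → ∀ {x} → x ∈ p i → x ∈ p j → MayShare i j x)

    -- The ends of the walks, from the arcs under the tokens on. `later` is the invariant that
    -- carries the backward induction over the rounds.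
    record Continuation (r : ℕ) (u : Vec Arc k) : Set where
      field
        rest     : Fin k → List Arc
        walk     : ∀ i → IsWalk G (src (lookup u i)) t (rest i)
        later    : ∀ i {x} → x ∈ rest i → x ≡ lookup u i ⊎ Level (suc r) x
        mayShare : ∀ i j → i ≢ j → ∀ {x} → x ∈ rest i → x ∈ rest j → MayShare i j x

    stop : ∀ r {u} → Valid u → Final u → Continuation r u
    stop r {u} valid final = record
      { rest     = λ i → lookup u i ∷ []
      ; walk     = λ i → refl , final i
      ; later    = λ { i (here eq) → inj₁ eq }
      ; mayShare = λ { i j i≢j (here refl) (here eq) → valid i j i≢j eq }
      }

    -- A token leaves an arc a only in the round r with a in level r but not in
    -- level 1 + r, whereas what follows lies in level 1 + r.  So two tokens that
    -- both traverse a occupy it at the same time.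
    prepend : ∀ r {u u′} → Valid u → Step r u u′ → Continuation (suc r) u′ → Continuation r u
    prepend r {u} {u′} valid step c = record
      { rest     = λ i → rest′ i (step i)
      ; walk     = λ i → walk′ i (step i)
      ; later    = λ i → later′ i (step i)
      ; mayShare = λ i j i≢j → share i j i≢j (step i) (step j)
      }
      where
      open Continuation c
      a b : Fin k → Arc
      a i = lookup u i
      b i = lookup u′ i

      rest′ : ∀ i → Moves r (a i) (b i) → List Arc
      rest′ i (inj₁ _) = rest i
      rest′ i (inj₂ _) = a i ∷ rest i

      walk′ : ∀ i m → IsWalk G (src (a i)) t (rest′ i m)
      walk′ i (inj₁ eq) = subst (λ x → IsWalk G (src x) t (rest i)) (sym eq) (walk i)
      walk′ i (inj₂ (_ , _ , eq)) = refl , subst (λ v → IsWalk G v t (rest i)) (sym eq) (walk i)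

      -- The new arc `b i` follows `a i` and so is in level `1 + r`; the others are even in level
      -- `2 + r`.
      later-moved : ∀ i → Level r (a i) → tgt (a i) ≡ src (b i) → ∀ {x} → x ∈ rest i → Level (suc r) x
      later-moved i l eq x∈ with later i x∈
      ... | inj₁ refl = a i , l , eq
      ... | inj₂ l′   = level-suc (suc r) l′

      later′ : ∀ i m {x} → x ∈ rest′ i m → x ≡ a i ⊎ Level (suc r) x
      later′ i (inj₁ eq) x∈ with later i x∈
      ... | inj₁ x≡ = inj₁ (trans x≡ (sym eq))
      ... | inj₂ l  = inj₂ (level-suc (suc r) l)
      later′ i (inj₂ _)            (here eq)  = inj₁ eq
      later′ i (inj₂ (l , _ , eq)) (there x∈) = inj₂ (later-moved i l eq x∈)

      left : ∀ i j → i ≢ j → ¬ Level (suc r) (a i) → ∀ m → a i ∈ rest′ j m → MayShare i j (a i)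
      left i j i≢j ¬l m x∈ with later′ j m x∈
      ... | inj₁ eq = valid i j i≢j eq
      ... | inj₂ l  = contradiction l ¬l

      left′ : ∀ i j → i ≢ j → ¬ Level (suc r) (a j) → ∀ m → a j ∈ rest′ i m → MayShare i j (a j)
      left′ i j i≢j ¬l m x∈ with later′ i m x∈
      ... | inj₁ eq = subst (MayShare i j) (sym eq) (valid i j i≢j (sym eq))
      ... | inj₂ l  = contradiction l ¬l

      share : ∀ i j → i ≢ j → ∀ m m′ {x} → x ∈ rest′ i m → x ∈ rest′ j m′ → MayShare i j x
      share i j i≢j (inj₂ (_ , ¬l , _)) m′ (here refl) x∈ = left i j i≢j ¬l m′ x∈
      share i j i≢j m (inj₂ (_ , ¬l , _)) x∈ (here refl)  = left′ i j i≢j ¬l m x∈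
      share i j i≢j (inj₁ _) (inj₁ _) x∈ x∈′                 = mayShare i j i≢j x∈ x∈′
      share i j i≢j (inj₁ _) (inj₂ _) x∈ (there x∈′)         = mayShare i j i≢j x∈ x∈′
      share i j i≢j (inj₂ _) (inj₁ _) (there x∈) x∈′         = mayShare i j i≢j x∈ x∈′
      share i j i≢j (inj₂ _) (inj₂ _) (there x∈) (there x∈′) = mayShare i j i≢j x∈ x∈′

    -- The rounds are undone from the last to the first, each one prepending the arcs that tokens
    -- left in it.
    reach⇒walks : ∀ r {u} → Reach r u → Continuation r u → ∃[ p ] WalkSystem p
    reach⇒walks zero (valid , start) c =
      rest , (λ i → subst (λ v → IsWalk G v t (rest i)) (start i) (walk i)) , mayShare
      where open Continuation c
    reach⇒walks (suc r) (_ , _ , reach , step) c =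
      reach⇒walks r reach (prepend r (reach-valid r reach) step c)

    -- Token runs from walks

    module _ {p : Fin k → List Arc} (s≢t : s ≢ t) (system : WalkSystem p) where

      -- `onTime` says that the token has not missed the round in which its arc can be left, unless
      -- its walk ends there.
      record Token (r : ℕ) (i : Fin k) : Set where
        field
          arc       : Arc
          remaining : List Arc
          walk      : IsWalk G (tgt arc) t remaining
          onPath    : ∀ {x} → x ∈ arc ∷ remaining → x ∈ p i
          onTime    : Level r arc ⊎ remaining ≡ []

      open Token

      startToken : ∀ i → Σ[ T ∈ Token 0 i ] src (arc T) ≡ s
      startToken i = first (p i) refl (proj₁ system i)
        where
        first : ∀ as → p i ≡ as → IsWalk G s t as → Σ[ T ∈ Token 0 i ] src (arc T) ≡ s
        -- A token needs an arc to stand on; `s ≢ t` excludes the empty walk.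
        first []       _  w        = contradiction w s≢t
        first (a ∷ as) eq (eq′ , w) = record
          { arc = a ; remaining = as ; walk = w
          ; onPath = subst (_ ∈_) (sym eq) ; onTime = inj₁ tt } , eq′

      -- The token waits while its arc is in the next level and otherwise moves on if its walk does.
      -- The arc it then enters follows one of level `r`, so it is in level `1 + r` and the token is
      -- on time again.
      advance : ∀ r i (T : Token r i) → Σ[ T′ ∈ Token (suc r) i ] Moves r (arc T) (arc T′)
      advance r i T with level? (suc r) (arc T) | remaining T in eq | walk T | onTime T
      ... | yes l | as | w | _ = record
        { arc = arc T ; remaining = as ; walk = w
        ; onPath = onPath T ∘ subst (λ as → _ ∈ arc T ∷ as) (sym eq)
        ; onTime = inj₁ l } , inj₁ refl
      ... | no ¬l | [] | w | _ = record
        { arc = arc T ; remaining = [] ; walk = w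
        ; onPath = onPath T ∘ subst (λ as → _ ∈ arc T ∷ as) (sym eq)
        ; onTime = inj₂ refl } , inj₁ refl
      ... | no ¬l | b ∷ bs | eq′ , w | inj₁ l = record
        { arc = b ; remaining = bs ; walk = w
        ; onPath = onPath T ∘ subst (λ as → _ ∈ arc T ∷ as) (sym eq) ∘ there
        ; onTime = inj₁ (arc T , l , sym eq′) } , inj₂ (l , ¬l , sym eq′)

      arcs : ∀ {r} → (∀ i → Token r i) → Vec Arc k
      arcs T = tabulate (arc ∘ T)

      valid-tokens : ∀ {r} (T : ∀ i → Token r i) → Valid (arcs T)
      valid-tokens T i j i≢j eq
        rewrite lookup∘tabulate (arc ∘ T) i | lookup∘tabulate (arc ∘ T) j =
        proj₂ system i j i≢j (onPath (T i) (here refl)) (onPath (T j) (here eq))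

      reach-tokens : ∀ r → Σ[ T ∈ (∀ i → Token r i) ] Reach r (arcs T)
      reach-tokens zero = T , valid-tokens T ,
        λ i → trans (cong src (lookup∘tabulate (arc ∘ T) i)) (proj₂ (startToken i))
        where T = proj₁ ∘ startToken
      reach-tokens (suc r) =
        let (T , reach) = reach-tokens r
            T′ = λ i → proj₁ (advance r i (T i))
        in T′ , valid-tokens T′ , arcs T , reach , λ i →
           subst₂ (Moves r) (sym (lookup∘tabulate (arc ∘ T) i)) (sym (lookup∘tabulate (arc ∘ T′) i))
             (proj₂ (advance r i (T i)))

      -- Level `#V` is empty, so after `#V` rounds being on time means that nothing of the walk
      -- remains.
      walks⇒reach : Acyclic G → ∃[ u ] Reach #V u × Final u
      walks⇒reach acyclic =
        let (T , reach) = reach-tokens #V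
        in arcs T , reach , λ i → trans (cong tgt (lookup∘tabulate (arc ∘ T) i))
             (final (remaining (T i)) (walk (T i)) (onTime (T i)))
        where
        final : ∀ {a} as → IsWalk G (tgt a) t as → Level #V a ⊎ as ≡ [] → tgt a ≡ t
        final []      eq _        = eq
        final (_ ∷ _) _  (inj₁ l) = contradiction l (level-#V-empty acyclic)

  -- Walk systems and almost disjoint paths

  guess : ∀ {k} → Vec Arc (k * k) → Fin k → Fin k → Arc
  guess g i j = lookup g (Fin.combine i j)

  module _ (acyclic : Acyclic G) {s t : Vertex} (s≢t : s ≢ t) {k : ℕ} where

    -- Common arcs of two walks all equal the guessed one. If the walks coincided, each of their
    -- arcs would be this arc: two in a row would make it a loop, and a single one would lead from
    -- `s` to `t`, which `MayShare` forbids.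
    walks⇒paths : ∀ {g p} → WalkSystem s t {k} g p → HasAlmostDisjointPaths G k s t
    walks⇒paths {g} {p} (walks , share) =
      p , (λ i → walk⇒path acyclic (walks i)) , (λ {i} {j} → injective i j) ,
      λ i j i≢j a∈ a∈′ b∈ b∈′ →
        trans (proj₁ (share i j i≢j a∈ a∈′)) (sym (proj₁ (share i j i≢j b∈ b∈′)))
      where
      shared-itself : ∀ as i j → IsWalk G s t as → ¬ (∀ {x} → x ∈ as → MayShare s t g i j x)
      shared-itself []       i j w h = s≢t w
      shared-itself (a ∷ []) i j (eq , eq′) h = proj₂ (h (here refl)) (eq , eq′)
      shared-itself (a ∷ b ∷ as) i j (eq , eq′ , w) h
        with a≡b ← trans (proj₁ (h (here refl))) (sym (proj₁ (h (there (here refl)))))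
        with () ← closed-walk-empty acyclic {src a} {a ∷ []}
                    (refl , trans (sym eq′) (cong src (sym a≡b)))

      injective : ∀ i j → p i ≡ p j → i ≡ j
      injective i j eq with i Fin.≟ j
      ... | yes i≡j = i≡j
      ... | no i≢j  = ⊥-elim (shared-itself (p i) i j (walks i)
        λ x∈ → share i j i≢j x∈ (subst (_ ∈_) eq x∈))

    common : (as bs : List Arc) → IsWalk G s t as → Arc
    common []       bs w = contradiction w s≢t
    common (a ∷ as) bs w with Any.any? (λ x → Any.any? (x Fin.≟_) bs) (a ∷ as)
    ... | yes x∈ = proj₁ (find x∈)
    -- Without a common arc any value will do; the first arc is at hand.
    ... | no _   = a

    common-∈ : (as bs : List Arc) (w : IsWalk G s t as) → ∀ {x} → x ∈ as → x ∈ bs →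
      common as bs w ∈ as × common as bs w ∈ bs
    common-∈ (a ∷ as) bs w x∈ x∈′ with Any.any? (λ x → Any.any? (x Fin.≟_) bs) (a ∷ as)
    ... | yes y∈ = proj₂ (find y∈)
    ... | no ¬∃  = contradiction (lose x∈ x∈′) ¬∃

    sharedArc : HasAlmostDisjointPaths G k s t → Fin k → Fin k → Arc
    sharedArc (p , paths , _) i j = common (p i) (p j) (proj₁ (paths i))

    -- By almost disjointness the chosen common arc is the only one. If it led from `s` to `t`, both
    -- paths would consist of it alone, against injectivity.
    paths⇒walks : (h : HasAlmostDisjointPaths G k s t) → WalkSystem s t (sharedArc h) (proj₁ h)
    paths⇒walks (p , paths , injective , disjoint) = (proj₁ ∘ paths) , λ i j i≢j x∈ x∈′ →
      let (c∈ , c∈′) = common-∈ (p i) (p j) (proj₁ (paths i)) x∈ x∈′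
      in disjoint i j i≢j x∈ x∈′ c∈ c∈′ , λ (eq , eq′) →
         i≢j (injective (trans (st-arc-path acyclic (proj₁ (paths i)) x∈ eq eq′)
           (sym (st-arc-path acyclic (proj₁ (paths j)) x∈′ eq eq′))))

    paths⇔reach :
      (HasAlmostDisjointPaths G k s t →
        ∃[ g ] ∃[ u ] Reach s t (guess g) #V u × Final s t (guess g) u) ×
      ((∃[ g ] ∃[ u ] Reach s t (guess g) #V u × Final s t (guess g) u) →
        HasAlmostDisjointPaths G k s t)
    proj₁ paths⇔reach h@(p , _) = g , walks⇒reach s t (guess g) s≢t (proj₁ system , λ i j i≢j x∈ x∈′ →
        let (eq , ¬st) = proj₂ system i j i≢j x∈ x∈′
        in trans eq (sym (guess-g i j)) , ¬st) acyclic
      where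
      system = paths⇒walks h
      -- `Fin.remQuot` recovers the pair of indices that `guess` flattens with `Fin.combine`.
      entry : Fin (k * k) → Arc
      entry c = sharedArc h (proj₁ (Fin.remQuot {k} k c)) (proj₂ (Fin.remQuot {k} k c))
      g = tabulate entry
      guess-g : ∀ i j → guess g i j ≡ sharedArc h i j
      guess-g i j = trans (lookup∘tabulate entry (Fin.combine i j))
        (cong (λ (i , j) → sharedArc h i j) (Fin.remQuot-combine i j))
    proj₂ paths⇔reach (g , u , reach , final) =
      walks⇒paths (proj₂ (reach⇒walks s t (guess g) #V reach
        (stop s t (guess g) #V (reach-valid s t (guess g) #V reach) final)))

  trivial-paths : Acyclic G → ∀ {s} k →
    (k ≤ 1 → HasAlmostDisjointPaths G k s s) × (HasAlmostDisjointPaths G k s s → k ≤ 1)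
  proj₁ (trivial-paths acyclic k) k≤1 =
    (λ _ → []) , (λ _ → refl , [] ∷ []) , (λ {i} {j} _ → subsingleton k≤1 i j) , λ _ _ _ ()
    where
    subsingleton : ∀ {k} → k ≤ 1 → (i j : Fin k) → i ≡ j
    subsingleton (s≤s z≤n) zero zero = refl
  proj₂ (trivial-paths acyclic zero)          _ = z≤n
  proj₂ (trivial-paths acyclic (suc zero))    _ = s≤s z≤n
  proj₂ (trivial-paths acyclic (suc (suc k))) (p , paths , injective , _)
    with () ← injective {zero} {suc zero}
      (trans (closed-walk-empty acyclic (proj₁ (paths zero)))
        (sym (closed-walk-empty acyclic (proj₁ (paths (suc zero))))))

-- The search as a term

-- The search stores an arc as (number . (source . target)), since parallel arcs have the same ends.
idᵗ srcᵗ tgtᵗ : ∀ {n} → Tm n → Tm n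
idᵗ  e = hdᵗ e
srcᵗ e = hdᵗ (tlᵗ e)
tgtᵗ e = tlᵗ (tlᵗ e)

sameArcᵗ memberᵗ : ∀ {n} → Tm n → Tm n → Tm n
sameArcᵗ a b = eqᵗ (idᵗ a) (idᵗ b)
memberᵗ a l = anyᵗ l (sameArcᵗ (wk a) (` zero))

moveᵗ : ∀ {n} (l l′ a b : Tm n) → Tm n
moveᵗ l l′ a b = orᵗ (sameArcᵗ a b)
  (andᵗ (memberᵗ a l) (andᵗ (notᵗ (memberᵗ a l′)) (eqᵗ (tgtᵗ a) (srcᵗ b))))

nextLevelᵗ : ∀ {n} (arcs l : Tm n) → Tm n
nextLevelᵗ arcs l = filterᵗ arcs (anyᵗ (wk l) (eqᵗ (tgtᵗ (` zero)) (srcᵗ (` suc zero))))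

-- The accumulator holds the next free number and the arcs numbered so far.
numberNextᵗ : ∀ {n} → Tm (2 + n)
numberNextᵗ = consᵗ (consᵗ nilᵗ (hdᵗ (` zero)))
  (consᵗ (consᵗ (hdᵗ (` zero)) (` suc zero)) (tlᵗ (` zero)))

numberᵗ : ∀ {n} → Tm n → Tm n
numberᵗ l = tlᵗ (foldᵗ l (consᵗ nilᵗ nilᵗ) numberNextᵗ)

tuplesᵗ : ∀ {n} → ℕ → Tm n → Tm n
tuplesᵗ zero    arcs = consᵗ nilᵗ nilᵗ
tuplesᵗ (suc j) arcs = letᵗ (tuplesᵗ j arcs)
  (foldᵗ (wk arcs) nilᵗ
    (foldᵗ (` suc (suc zero)) (` zero)
      -- Variable 3 is the new first arc, variable 1 the shorter tuple.
      (consᵗ (consᵗ (` suc (suc (suc zero))) (` suc zero)) (` zero))))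

module _ (k : ℕ) where

  validPairᵗ : ∀ {n} (s t g u : Tm n) (i j : Fin k) → Tm n
  validPairᵗ s t g u i j =
    -- The indices are constants of the program, so this test is made when the term is built and not
    -- when it runs.
    if does (i Fin.≟ j) then trueᵗ else
    impᵗ (sameArcᵗ (nthᵗ i u) (nthᵗ j u))
      (andᵗ (sameArcᵗ (nthᵗ i u) (nthᵗ (Fin.combine i j) g))
        (notᵗ (andᵗ (eqᵗ (srcᵗ (nthᵗ i u)) s) (eqᵗ (tgtᵗ (nthᵗ i u)) t))))

  validᵗ : ∀ {n} (s t g u : Tm n) → Tm n
  validᵗ s t g u = allᵗ k λ i → allᵗ k λ j → validPairᵗ s t g u i j

  stepᵗ : ∀ {n} (l l′ u u′ : Tm n) → Tm n
  stepᵗ l l′ u u′ = allᵗ k λ i → moveᵗ l l′ (nthᵗ i u) (nthᵗ i u′)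

  startsᵗ : ∀ {n} (s t g us : Tm n) → Tm n
  startsᵗ s t g us = filterᵗ us
    (andᵗ (validᵗ (wk s) (wk t) (wk g) (` zero))
      (allᵗ k λ i → eqᵗ (srcᵗ (nthᵗ i (` zero))) (wk s)))

  nextsᵗ : ∀ {n} (s t g us l l′ now : Tm n) → Tm n
  nextsᵗ s t g us l l′ now = filterᵗ us
    (andᵗ (validᵗ (wk s) (wk t) (wk g) (` zero))
      (anyᵗ (wk now) (stepᵗ (wk (wk l)) (wk (wk l′)) (` zero) (` suc zero))))

  -- The accumulator pairs the current level with the tuples reached so far. The list folded over is
  -- the unary numeral `#V`, which counts the rounds.
  roundᵗ : ∀ {n} (s t g arcs us : Tm n) → Tm (2 + n)
  roundᵗ s t g arcs us = letᵗ (nextLevelᵗ (wk (wk arcs)) (hdᵗ (` zero)))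
    (consᵗ (` zero)
      (nextsᵗ (wk (wk (wk s))) (wk (wk (wk t))) (wk (wk (wk g))) (wk (wk (wk us)))
        (hdᵗ (` suc zero)) (` zero) (tlᵗ (` suc zero))))

  searchᵗ : ∀ {n} (v s t g arcs us : Tm n) → Tm n
  searchᵗ v s t g arcs us =
    anyᵗ (tlᵗ (foldᵗ v (consᵗ arcs (startsᵗ s t g us)) (roundᵗ s t g arcs us)))
      (allᵗ k λ i → eqᵗ (tgtᵗ (nthᵗ i (` zero))) (wk t))

  adpᵗ : Tm 1
  adpᵗ = ifᵗ (eqᵗ s t) (if does (k ≤? 1) then trueᵗ else nilᵗ)
    (letᵗ (numberᵗ (hdᵗ (tlᵗ (` zero))))
      (letᵗ (tuplesᵗ k (` zero))
        (anyᵗ (tuplesᵗ (k * k) (` suc zero))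
          (searchᵗ (wk (wk (wk v))) (wk (wk (wk s))) (wk (wk (wk t)))
            (` zero) (` suc (suc zero)) (` suc zero)))))
    where
    v s t : Tm 1
    v = hdᵗ (` zero)
    s = hdᵗ (tlᵗ (tlᵗ (` zero)))
    t = tlᵗ (tlᵗ (tlᵗ (` zero)))

-- Correctness of the search

module _ (G : Digraph) {M : ℕ} where
  open Digraph G

  encodeVertex : Vertex → Tree
  encodeVertex v = encodeℕ (toℕ v)

  encodeEnds encodeArc : Arc → Tree
  encodeEnds a = cons (encodeVertex (src a)) (encodeVertex (tgt a))
  encodeArc  a = cons (encodeℕ (toℕ a)) (encodeEnds a)

  encodeTuple : ∀ {j} → Vec Arc j → Tree
  encodeTuple u = encodeAll encodeArc (Vec.toList u)

  ev-number : ∀ {n} {ρ : Vec Tree n} {e} →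
    Eval M ρ e (encodeList (List.tabulate encodeEnds)) →
    #A ≤ M → ∃[ as ] Eval M ρ (numberᵗ e) (encodeAll encodeArc as) × length as ≡ #A × (∀ a → a ∈ as)
  ev-number {ρ = ρ} e #A≤M =
    let (as , it , len , _ , all) = iter #A (λ a → a) 0 [] (λ _ → refl)
    in as ,
       ev-tl (ev-fold e (subst (_≤ M) (sym (spine-tabulate #A _)) #A≤M) (ev-cons ev-nil ev-nil) it) ,
       trans len (+-identityʳ #A) , all
    where
    spine-tabulate : ∀ n (f : Fin n → Tree) → spine (encodeList (List.tabulate f)) ≡ n
    spine-tabulate zero    f = refl
    spine-tabulate (suc n) f = cong suc (spine-tabulate n (f ∘ suc))

    -- Stated for any run of arcs numbered consecutively from `c`, as the fold takes them off the
    -- front.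
    iter : ∀ n (f : Fin n → Arc) c as → (∀ i → toℕ (f i) ≡ c + toℕ i) → ∃[ bs ]
      Iter M ρ numberNextᵗ (encodeList (List.tabulate (encodeEnds ∘ f)))
        (cons (encodeℕ c) (encodeAll encodeArc as)) (cons (encodeℕ (n + c)) (encodeAll encodeArc bs)) ×
      length bs ≡ n + length as × (∀ {a} → a ∈ as → a ∈ bs) × (∀ i → f i ∈ bs)
    iter zero    f c as eq = as , it-nil , refl , (λ a∈ → a∈) , λ ()
    iter (suc n) f c as eq =
      let (bs , it , len , old , new) = iter n (f ∘ suc) (suc c) (f zero ∷ as)
            λ i → trans (eq (suc i)) (+-suc c (toℕ i))
      in bs , it-cons
           (ev-cons (ev-cons ev-nil (ev-hd (ev-var zero)))
             (ev-cons (ev-cons (ev-hd (ev-var zero)) (ev-var (suc zero))) (ev-tl (ev-var zero))))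
           (subst₂ (λ x y → Iter M ρ numberNextᵗ (encodeList (List.tabulate (encodeEnds ∘ f ∘ suc)))
               (cons (encodeℕ (suc c))
                 (cons (cons (encodeℕ x) (encodeEnds (f zero))) (encodeAll encodeArc as)))
               (cons (encodeℕ y) (encodeAll encodeArc bs)))
             (trans (eq zero) (+-identityʳ c)) (+-suc n c) it) ,
         trans len (+-suc n (length as)) , old ∘ there ,
         λ { zero → old (here refl) ; (suc i) → new i }

  -- The lists of shorter tuples are folded over as well, so every power up to `j` has to stay
  -- within `M`.
  ev-tuples : ∀ {n} {ρ : Vec Tree n} {e as} j → Eval M ρ e (encodeAll encodeArc as) →
    length as ≤ M → (∀ a → a ∈ as) → (∀ {i} → i ≤ j → length as ^ i ≤ M) →
    ∃[ us ] Eval M ρ (tuplesᵗ j e) (encodeAll (encodeTuple {j}) us) ×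
      length us ≡ length as ^ j × (∀ u → u ∈ us)
  ev-tuples zero e _ _ _ = [] ∷ [] , ev-cons ev-nil ev-nil , refl , λ { [] → here refl }
  ev-tuples {n} {ρ} {as = as} (suc j) e as≤M all bound =
    let (us , d , len , all-us) = ev-tuples j e as≤M all λ i≤j → bound (m≤n⇒m≤1+n i≤j)
        (vs , it , len′ , _ , all-vs) = outer us (subst (_≤ M) (sym len) (bound (n≤1+n j))) as []
    in vs , ev-let d (ev-foldList {f = encodeArc} {as} (ev-wk e) as≤M ev-nil it) ,
       trans len′ (trans (+-identityʳ _) (cong (length as *_) len)) ,
       λ { (a ∷ u) → all-vs (all a) (all-us u) }
    where
    inner : ∀ {m} {ρ′ : Vec Tree m} {y} a (us : List (Vec Arc j)) vs → ∃[ ws ]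
      Iter M (y ∷ encodeArc a ∷ ρ′) (consᵗ (consᵗ (` suc (suc (suc zero))) (` suc zero)) (` zero))
        (encodeAll encodeTuple us) (encodeAll encodeTuple vs) (encodeAll encodeTuple ws) ×
      length ws ≡ length us + length vs × (∀ {v} → v ∈ vs → v ∈ ws) × (∀ {u} → u ∈ us → a ∷ u ∈ ws)
    inner a []       vs = vs , it-nil , refl , (λ v∈ → v∈) , λ ()
    inner a (u ∷ us) vs =
      let (ws , it , len , old , new) = inner a us ((a ∷ u) ∷ vs)
      in ws , it-cons (ev-cons (ev-cons (ev-var _) (ev-var _)) (ev-var _)) it ,
         trans len (+-suc (length us) (length vs)) , old ∘ there ,
         λ { (here refl) → old (here refl) ; (there u∈) → new u∈ }

    outer : ∀ (us : List (Vec Arc j)) → length us ≤ M → ∀ as vs → ∃[ ws ]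
      Iter M (encodeAll encodeTuple us ∷ ρ)
        (foldᵗ (` suc (suc zero)) (` zero)
          (consᵗ (consᵗ (` suc (suc (suc zero))) (` suc zero)) (` zero)))
        (encodeAll encodeArc as) (encodeAll encodeTuple vs) (encodeAll encodeTuple ws) ×
      length ws ≡ length as * length us + length vs ×
      (∀ {v} → v ∈ vs → v ∈ ws) × (∀ {a u} → a ∈ as → u ∈ us → a ∷ u ∈ ws)
    outer us us≤M []       vs = vs , it-nil , refl , (λ v∈ → v∈) , λ ()
    outer us us≤M (a ∷ as) vs =
      let (ws , it , len , old , new) = inner a us vs
          (xs , it′ , len′ , old′ , new′) = outer us us≤M as ws
      in xs , it-cons (ev-foldList {f = encodeTuple} {us} (ev-var _) us≤M (ev-var zero) it) it′ ,
         (begin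
           length xs                                           ≡⟨ len′ ⟩
           length as * length us + length ws                   ≡⟨ cong (length as * length us +_) len ⟩
           length as * length us + (length us + length vs)     ≡⟨ +-assoc (length as * length us) _ _ ⟨
           length as * length us + length us + length vs
             ≡⟨ cong (_+ length vs) (+-comm (length as * length us) _) ⟩
           length us + length as * length us + length vs       ∎) ,
         old′ ∘ old ,
         λ { (here refl) u∈ → old′ (new u∈) ; (there a∈) u∈ → new′ a∈ u∈ }
      where open ≡-Reasoning

  module _ (#V≤M : #V ≤ M) (#A≤M : #A ≤ M) where

    module _ {n} {ρ : Vec Tree n} where

      decides-sameVertex : ∀ {e f v w} → Eval M ρ e (encodeVertex v) → Eval M ρ f (encodeVertex w) →
        Decides M ρ (eqᵗ e f) (v ≡ w)
      decides-sameVertex {v = v} d d′ = decides-map Fin.toℕ-injective (cong toℕ)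
        (decides-eq d d′ (≤-trans (Fin.toℕ≤n v) #V≤M))

      decides-sameArc : ∀ {e f a b} → Eval M ρ e (encodeArc a) → Eval M ρ f (encodeArc b) →
        Decides M ρ (sameArcᵗ e f) (a ≡ b)
      decides-sameArc {a = a} d d′ = decides-map Fin.toℕ-injective (cong toℕ)
        (decides-eq (ev-hd d) (ev-hd d′) (≤-trans (Fin.toℕ≤n a) #A≤M))

      ev-src : ∀ {e a} → Eval M ρ e (encodeArc a) → Eval M ρ (srcᵗ e) (encodeVertex (src a))
      ev-src d = ev-hd (ev-tl d)

      ev-tgt : ∀ {e a} → Eval M ρ e (encodeArc a) → Eval M ρ (tgtᵗ e) (encodeVertex (tgt a))
      ev-tgt d = ev-tl (ev-tl d)

      ev-component : ∀ {e j} {u : Vec Arc j} i → Eval M ρ e (encodeTuple u) →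
        Eval M ρ (nthᵗ i e) (encodeArc (lookup u i))
      ev-component {u = u} i = ev-nth {f = encodeArc} {v = u} i

    -- The list represents the set `P`, with order and repetitions left open, and is short enough
    -- for a fold.
    record Lists {A : Set} (P : A → Set) (xs : List A) : Set where
      constructor lists
      field
        short    : length xs ≤ M
        sound    : ∀ {x} → x ∈ xs → P x
        complete : ∀ {x} → P x → x ∈ xs
    open Lists

    module _ {n} {ρ : Vec Tree n} {A : Set} {f : A → Tree} {P : A → Set} {φ : Tm (suc n)} where

      decides-exists : ∀ {Q e xs} → Eval M ρ e (encodeAll f xs) → Lists Q xs →
        (∀ x → Decides M (f x ∷ ρ) φ (P x)) → Decides M ρ (anyᵗ e φ) (∃[ x ] Q x × P x)
      decides-exists {xs = xs} e l d = decides-map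
        (λ (x , x∈ , p) → x , sound l x∈ , p) (λ (x , q , p) → x , complete l q , p)
        (decides-any {f = f} d {xs = xs} e (short l))

      ev-comprehension : ∀ {e xs} → Eval M ρ e (encodeAll f xs) → Lists (λ _ → ⊤) xs →
        (∀ x → Decides M (f x ∷ ρ) φ (P x)) →
        ∃[ ys ] Eval M ρ (filterᵗ e φ) (encodeAll f ys) × Lists P ys
      ev-comprehension {xs = xs} e l d =
        let (ys , e′ , len , to , from) = ev-filter {f = f} d {xs = xs} e (short l)
        in ys , e′ , lists (≤-trans len (short l)) (proj₂ ∘ to) (from (complete l tt))

    module _ {n} {ρ : Vec Tree n} where

      decides-member : ∀ {e l P a as} → Eval M ρ e (encodeArc a) →
        Eval M ρ l (encodeAll encodeArc as) → Lists P as → Decides M ρ (memberᵗ e l) (P a)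
      decides-member {P = P} {a} {as} d d′ l = decides-map
        (λ { (_ , p , refl) → p }) (λ p → a , p , refl)
        (decides-exists {f = encodeArc} {xs = as} d′ l λ b → decides-sameArc (ev-wk d) (ev-var zero))

      ev-nextLevel : ∀ {e l as ls} r → Eval M ρ e (encodeAll encodeArc as) → Lists (λ _ → ⊤) as →
        Eval M ρ l (encodeAll encodeArc ls) → Lists (Level G r) ls →
        ∃[ ls′ ] Eval M ρ (nextLevelᵗ e l) (encodeAll encodeArc ls′) × Lists (Level G (suc r)) ls′
      ev-nextLevel {as = as} {ls} r d all d′ l =
        ev-comprehension {f = encodeArc} {xs = as} d all λ b →
        decides-exists {f = encodeArc} {xs = ls} (ev-wk d′) l λ a →
        decides-sameVertex (ev-tgt {a = a} (ev-var zero)) (ev-src {a = b} (ev-var (suc zero)))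

    module _ (s t : Vertex) {k : ℕ} (g : Vec Arc (k * k)) where

      private
        γ : Fin k → Fin k → Arc
        γ = guess G g

      module _ {n} {ρ : Vec Tree n} where

        decides-move : ∀ {l l′ e f ls ls′ a b} r →
          Eval M ρ l (encodeAll encodeArc ls) → Lists (Level G r) ls →
          Eval M ρ l′ (encodeAll encodeArc ls′) → Lists (Level G (suc r)) ls′ →
          Eval M ρ e (encodeArc a) → Eval M ρ f (encodeArc b) →
          Decides M ρ (moveᵗ l l′ e f) (Moves G s t γ r a b)
        decides-move {ls = ls} {ls′} {a} {b} r d l d′ l′ e f =
          decides-or (decides-sameArc {a = a} {b} e f)
            (decides-and (decides-member {as = ls} e d l)
              (decides-and (decides-not (decides-member {as = ls′} e d′ l′))
                (decides-sameVertex (ev-tgt {a = a} e) (ev-src {a = b} f))))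

        decides-valid : ∀ {sᵗ tᵗ e f u} → Eval M ρ sᵗ (encodeVertex s) → Eval M ρ tᵗ (encodeVertex t) →
          Eval M ρ e (encodeTuple g) → Eval M ρ f (encodeTuple u) →
          Decides M ρ (validᵗ k sᵗ tᵗ e f) (Valid G s t γ u)
        decides-valid {sᵗ} {tᵗ} {e} {f} {u} ds dt dg du = decides-all k λ i → decides-all k (pair i)
          where
          dui : ∀ i → Eval M ρ (nthᵗ i f) (encodeArc (lookup u i))
          dui i = ev-component {u = u} i du

          pair : ∀ i j → Decides M ρ (validPairᵗ k sᵗ tᵗ e f i j)
            (i ≢ j → lookup u i ≡ lookup u j → MayShare G s t γ i j (lookup u i))
          pair i j with i Fin.≟ j
          ... | yes i≡j = decides-true λ i≢j → contradiction i≡j i≢j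
          ... | no i≢j  = decides-map (λ h _ → h) (λ h → h i≢j)
            (decides-imp (decides-sameArc {a = lookup u i} {lookup u j} (dui i) (dui j))
              (decides-and
                (decides-sameArc {a = lookup u i} {γ i j} (dui i)
                  (ev-component {u = g} (Fin.combine i j) dg))
                (decides-not (decides-and
                  (decides-sameVertex (ev-src {a = lookup u i} (dui i)) ds)
                  (decides-sameVertex (ev-tgt {a = lookup u i} (dui i)) dt)))))

      module _ {n} {ρ : Vec Tree n} {sᵗ tᵗ gᵗ arcsᵗ usᵗ : Tm n} {as us}
        (ds : Eval M ρ sᵗ (encodeVertex s)) (dt : Eval M ρ tᵗ (encodeVertex t))
        (dg : Eval M ρ gᵗ (encodeTuple g))
        (das : Eval M ρ arcsᵗ (encodeAll encodeArc as)) (all-as : Lists (λ _ → ⊤) as)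
        (dus : Eval M ρ usᵗ (encodeAll (encodeTuple {k}) us)) (all-us : Lists (λ _ → ⊤) us) where

        ev-starts : ∃[ ws ] Eval M ρ (startsᵗ k sᵗ tᵗ gᵗ usᵗ) (encodeAll encodeTuple ws) ×
          Lists (Reach G s t γ 0) ws
        ev-starts = ev-comprehension {f = encodeTuple} {xs = us} dus all-us λ u →
          decides-and (decides-valid {u = u} (ev-wk ds) (ev-wk dt) (ev-wk dg) (ev-var zero))
            (decides-all k λ i → decides-sameVertex
              (ev-src {a = lookup u i} (ev-component {u = u} i (ev-var zero))) (ev-wk ds))

        -- The loop invariant, with `r` rounds done and `c` to go.
        iter-rounds : ∀ c r ls ws → Lists (Level G r) ls → Lists (Reach G s t γ r) ws →
          ∃[ l ] ∃[ ws′ ]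
            Iter M ρ (roundᵗ k sᵗ tᵗ gᵗ arcsᵗ usᵗ) (encodeℕ c)
              (cons (encodeAll encodeArc ls) (encodeAll encodeTuple ws))
              (cons l (encodeAll encodeTuple ws′)) ×
            Lists (Reach G s t γ (c + r)) ws′
        iter-rounds zero    r ls ws hl hw = _ , ws , it-nil , hw
        iter-rounds (suc c) r ls ws hl hw =
          let (ls′ , dl , hl′) = ev-nextLevel {as = as} {ls} r (ev-wk (ev-wk das)) all-as
                (ev-hd (ev-var zero)) hl
              (ws′ , dw , hw′) = ev-comprehension {f = encodeTuple} {P = Reach G s t γ (suc r)} {xs = us}
                (ev-wk (ev-wk (ev-wk dus))) all-us λ u′ →
                decides-and
                  (decides-valid {u = u′} (ev-wk (ev-wk (ev-wk (ev-wk ds))))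
                    (ev-wk (ev-wk (ev-wk (ev-wk dt)))) (ev-wk (ev-wk (ev-wk (ev-wk dg)))) (ev-var zero))
                  (decides-exists {f = encodeTuple} {xs = ws} (ev-wk (ev-tl (ev-var (suc zero)))) hw
                    λ u →
                    decides-all k λ i → decides-move {ls = ls} {ls′} {lookup u i} {lookup u′ i} r
                      (ev-wk (ev-wk (ev-hd (ev-var (suc zero))))) hl (ev-wk (ev-wk (ev-var zero))) hl′
                      (ev-component {u = u} i (ev-var zero))
                      (ev-component {u = u′} i (ev-var (suc zero))))
              (l , ws″ , it , hw″) = iter-rounds c (suc r) ls′ ws′ hl′ hw′
          in l , ws″ , it-cons (ev-let dl (ev-cons (ev-var zero) dw)) it ,
             subst (λ r → Lists (Reach G s t γ r) ws″) (+-suc c r) hw″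

        decides-search : ∀ {v} → Eval M ρ v (encodeℕ #V) →
          Decides M ρ (searchᵗ k v sᵗ tᵗ gᵗ arcsᵗ usᵗ) (∃[ u ] Reach G s t γ #V u × Final G s t γ u)
        decides-search dv =
          let (ws , dw , hw) = ev-starts
              -- Level 0 contains every arc, so `as` is a list of it.
              (_ , ws′ , it , hw′) = iter-rounds #V 0 as ws
                (lists (short all-as) (λ _ → tt) (complete all-as)) hw
          in decides-exists {f = encodeTuple} {xs = ws′}
               (ev-tl (ev-fold dv (subst (_≤ M) (sym (spine-encodeℕ #V)) #V≤M) (ev-cons das dw) it))
               (subst (λ r → Lists (Reach G s t γ r) ws′) (+-identityʳ #V) hw′)
               λ u → decides-all k λ i → decides-sameVertex
                 (ev-tgt {a = lookup u i} (ev-component {u = u} i (ev-var zero))) (ev-wk dt)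

decides-adp : ∀ k I → Decides ((1 + size I) ^ (1 + k * k)) (encode I ∷ []) (adpᵗ k) (ADP k I)
decides-adp k I = decides-if (decides-sameVertex G #V≤M #A≤M {v = s} {t} ds dt) same different
  where
  open DAGInstance I renaming (graph to G)
  N = 1 + size I
  -- One bound for the numbers of vertices, arcs, tuples and guesses. The summand 1 keeps `N` itself
  -- below `M` when `k` is 0.
  M = N ^ (1 + k * k)
  ρ = encode I ∷ []

  power≤M : ∀ {x i} → x ≤ N → i ≤ 1 + k * k → x ^ i ≤ M
  power≤M {x} {i} x≤N i≤ = ≤-trans (^-monoˡ-≤ i x≤N) (^-monoʳ-≤ N i≤)

  ≤M : ∀ {x} → x ≤ N → x ≤ M
  ≤M {x} x≤N = subst (_≤ M) (^-identityʳ x) (power≤M x≤N (s≤s z≤n))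

  #V≤M : #V ≤ M
  #V≤M = ≤M (m≤n⇒m≤1+n (m≤m+n #V #A))
  #A≤N : #A ≤ N
  #A≤N = m≤n⇒m≤1+n (m≤n+m #A #V)
  #A≤M : #A ≤ M
  #A≤M = ≤M #A≤N

  ds : Eval M ρ _ (encodeVertex G {M} s)
  ds = ev-hd (ev-tl (ev-tl (ev-var zero)))
  dt : Eval M ρ _ (encodeVertex G {M} t)
  dt = ev-tl (ev-tl (ev-tl (ev-var zero)))

  k≤k*k : k ≤ k * k
  k≤k*k = m≤m*m k
    where
    m≤m*m : ∀ m → m ≤ m * m
    m≤m*m zero    = z≤n
    m≤m*m (suc m) = m≤m*n (suc m) (suc m)

  same : s ≡ t → Decides M ρ (if does (k ≤? 1) then trueᵗ else nilᵗ) (ADP k I)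
  same refl = decides-map (proj₁ (trivial-paths G acyclic k)) (proj₂ (trivial-paths G acyclic k))
    (decides-constant (k ≤? 1))

  different : s ≢ t → Decides M ρ _ (ADP k I)
  different s≢t =
    let (as , das , len , all-as) = ev-number G {e = hdᵗ (tlᵗ (` zero))}
          (ev-hd (ev-tl (ev-var zero))) #A≤M
        as≤N : length as ≤ N
        as≤N = subst (_≤ N) (sym len) #A≤N
        (us , dus , len-us , all-us) = ev-tuples G {as = as} k (ev-var zero) (≤M as≤N) all-as
          λ i≤ → power≤M as≤N (m≤n⇒m≤1+n (≤-trans i≤ k≤k*k))
        (gs , dgs , len-gs , all-gs) = ev-tuples G {as = as} (k * k) (ev-var (suc zero)) (≤M as≤N) all-as
          λ i≤ → power≤M as≤N (m≤n⇒m≤1+n i≤)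
    in decides-let das (decides-let dus (decides-map
         (λ (g , _ , h) → proj₂ (paths⇔reach G acyclic s≢t) (g , h))
         (λ h → let (g , h′) = proj₁ (paths⇔reach G acyclic s≢t) h in g , tt , h′)
         (decides-exists G #V≤M #A≤M {f = encodeTuple G {M}} {xs = gs} dgs
           (lists (subst (_≤ M) (sym len-gs) (power≤M as≤N (n≤1+n _))) (λ _ → tt) (λ {g} _ → all-gs g))
           λ g → decides-search G #V≤M #A≤M s t g
             (ev-wk (ev-wk (ev-wk ds))) (ev-wk (ev-wk (ev-wk dt))) (ev-var zero)
             (ev-var (suc (suc zero))) (lists {xs = as} (≤M as≤N) (λ _ → tt) (λ {a} _ → all-as a))
             (ev-var (suc zero))
             (lists {xs = us} (subst (_≤ M) (sym len-us) (power≤M as≤N (m≤n⇒m≤1+n k≤k*k)))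
               (λ _ → tt) (λ {u} _ → all-us u))
             (ev-wk (ev-wk (ev-wk (ev-hd (ev-var zero))))))))

theorem4 : (k : ℕ) → DecidableInPolynomialTime encode size (ADP k)
theorem4 k = term⇒polynomialTime encode size (ADP k) (adpᵗ k) (1 + k * k) (decides-adp k)
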